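{- For any regular language family $\mathcal{K}$ and any language $K'$, if $\mathcal{K}$ shuffle-reduces to $K'$, then there is a polynomial-time reduction from $\mathrm{CTS}[\mathcal{K}]$ to $\mathrm{CTS}[K']$, and a polynomial-time reduction from $\mathrm{CSh}[\mathcal{K}]$ to $\mathrm{CSh}[K']$.
   Context: All languages are over a fixed finite alphabet $A$. For words $u,v\in A^*$, $u ⧢ v$ denotes the shuffle of $u$ and $v$, i.e. the set of words obtained by interleaving $u$ and $v$; the shuffle of a tuple $U$ of words is the set of all interleavings of the words of $U$. An $A$-DAG is a finite directed acyclic graph $G=(V,E)$, $V=\{1,\dots,n\}$, with a labeling $\lambda:V\to A$. For a language $K$, $\mathrm{CTS}[K]$ asks, given an $A$-DAG $G$, whether there is a topological sort $\sigma$ of $G$ (a bijection $\sigma:\{1,\dots,n\}\to V$ with $\sigma^{ -1}(u)<\sigma^{ -1}(v)$ for all $(u,v)\in E$) with $\lambda(\sigma(1))\cdots\lambda(\sigma(n))\in K$. $\mathrm{CSh}[K]$ asks, given a tuple $U$ of words of $A^*$, whether the shuffle of $U$ contains a word of $K$. A regular language family $\mathcal{K}$ is a (generally infinite) family of regular languages, each described by a regular expression. $\mathrm{CTS}[\mathcal{K}]$ (resp. $\mathrm{CSh}[\mathcal{K}]$) is the problem whose input is a regular expression $K\in\mathcal{K}$ together with an $A$-DAG (resp. a tuple of words), and which asks whether it is a positive instance of $\mathrm{CTS}[K]$ (resp. $\mathrm{CSh}[K]$). A filter sequence for languages $K$ and $K'$ is an infinite sequence $(f_n)_{n\in\mathbb{N}}$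 of words of $A^*$ such that for every $n\in\mathbb{N}$ and every $v\in A^*$ with $|v|=n$, we have $v\in K$ iff $(v ⧢ f_n)\cap K'\neq\emptyset$. The language $K$ shuffle-reduces to $K'$ if there is a filter sequence $(f_n)$ for $K$ and $K'$ such that $i\mapsto f_i$ is computable in polynomial time, where $i$ is given in unary. A regular language family $\mathcal{K}$ shuffle-reduces to $K'$ if each $K\in\mathcal{K}$ does, and moreover one can compute in polynomial time the function $(K,i)\mapsto f_i^K$ that maps a regular expression $K$ of $\mathcal{K}$ and an integer $i$ in unary to the $i$-th word of a filter sequence $(f_n^K)$ for $K$ and $K'$. -}

module Defs where

open import Data.Empty using (⊥)
open import Data.Fin.Base using (Fin; toℕ; _<_)
open import Data.Fin.Permutation using (Permutation′; _⟨$⟩ʳ_; _⟨$⟩ˡ_)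
open import Data.List.Base
  using (List; []; _∷_; [_]; _++_; map; concat; concatMap; replicate; tabulate; length)
open import Data.List.Membership.Propositional using (_∈_)
open import Data.List.Relation.Ternary.Interleaving.Propositional using (Interleaving)
open import Data.List.Relation.Unary.All using (All)
open import Data.Maybe.Base as Maybe using (Maybe; just; nothing)
open import Data.Nat.Base using (ℕ; zero; suc; _+_; _*_; _^_; _≤_)
open import Data.Product.Base using (Σ; Σ-syntax; ∃-syntax; _×_; _,_; proj₂)
open import Data.Sum.Base using (_⊎_; inj₁)
open import Data.Vec.Base as Vec using (Vec)
open import Function.Bundles using (_⇔_)
open import Level using (Level; 0ℓ) renaming (suc to lsuc; _⊔_ to _⊔ˡ_)
open import Relation.Binary.Construct.Closure.Transitive using (TransClosure)
open import Relation.Binary.PropositionalEquality.Core using (_≡_)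
open import Relation.Nullary.Negation.Core using (¬_)
open import Relation.Unary using (Pred)

private
  variable
    k : ℕ
    a b i j ℓ ℓ′ : Level

------------------------------------------------------------------------
-- Words and languages over the alphabet A = Fin k

Word : ℕ → Set
Word k = List (Fin k)

Language : ℕ → (ℓ : Level) → Set (lsuc ℓ)
Language k ℓ = Pred (Word k) ℓ

-- w ∈ u ⧢ v is the library's Interleaving u v w.  The shuffle of a tuple
-- is obtained by interleaving its words one after the other.

data Shuffle {k : ℕ} : List (Word k) → Word k → Set where
  []  : Shuffle [] []
  _∷_ : ∀ {u us w w′} → Interleaving u w w′ → Shuffle us w → Shuffle (u ∷ us) w′

infixr 6 _∪_
infixr 7 _∙_
infix  8 _⋆

data Regex (k : ℕ) : Set where
  ∅ ε     : Regex k
  char    : Fin k → Regex k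
  _∪_ _∙_ : Regex k → Regex k → Regex k
  _⋆      : Regex k → Regex k

⟦_⟧ : Regex k → Language k 0ℓ
⟦ ∅ ⟧      w = ⊥
⟦ ε ⟧      w = w ≡ []
⟦ char c ⟧ w = w ≡ [ c ]
⟦ r ∪ s ⟧  w = ⟦ r ⟧ w ⊎ ⟦ s ⟧ w
⟦ r ∙ s ⟧  w = ∃[ u ] ∃[ v ] w ≡ u ++ v × ⟦ r ⟧ u × ⟦ s ⟧ v
⟦ r ⋆ ⟧    w = ∃[ ws ] w ≡ concat ws × All ⟦ r ⟧ ws

-- Each language of the family is given by a regular expression.

RegularFamily : ℕ → (ℓ : Level) → Set (lsuc ℓ)
RegularFamily k ℓ = Pred (Regex k) ℓ

------------------------------------------------------------------------
-- Labelled DAGs and topological sorts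

-- The finite set E ⊆ V × V is given by a list of its elements; order and
-- repetitions are irrelevant.

record DAG (k : ℕ) : Set where
  field
    size    : ℕ
    label   : Fin size → Fin k
    edges   : List (Fin size × Fin size)

  Edge : Fin size → Fin size → Set
  Edge u v = (u , v) ∈ edges

  field
    acyclic : ∀ v → ¬ TransClosure Edge v v

IsTopologicalSort : (G : DAG k) → Permutation′ (DAG.size G) → Set
IsTopologicalSort G σ = ∀ u v → DAG.Edge G u v → σ ⟨$⟩ˡ u < σ ⟨$⟩ˡ v

sortedWord : (G : DAG k) → Permutation′ (DAG.size G) → Word k
sortedWord G σ = tabulate (λ p → DAG.label G (σ ⟨$⟩ʳ p))

------------------------------------------------------------------------
-- Deterministic multi-tape Turing machines with input alphabet S

data Move : Set where
  left stay right : Move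

-- A two-way infinite tape: the cells left of the head (nearest first), the
-- scanned cell, the cells right of the head.  Cells not listed are blank.

record Tape (Γ : Set) : Set where
  constructor tape
  field
    before  : List (Maybe Γ)
    scanned : Maybe Γ
    after   : List (Maybe Γ)

open Tape public

-- Write a cell (nothing is the blank), then move.

act : ∀ {Γ : Set} → Tape Γ → Maybe Γ × Move → Tape Γ
act (tape []       _ rs)       (c , left)  = tape []       nothing (c ∷ rs)
act (tape (l ∷ ls) _ rs)       (c , left)  = tape ls       l       (c ∷ rs)
act (tape ls       _ rs)       (c , stay)  = tape ls       c       rs
act (tape ls       _ [])       (c , right) = tape (c ∷ ls) nothing []
act (tape ls       _ (r ∷ rs)) (c , right) = tape (c ∷ ls) r       rs

blankTape : ∀ {Γ : Set} → Tape Γ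
blankTape = tape [] nothing []

written : ∀ {Γ : Set} → List Γ → Tape Γ
written []       = blankTape
written (x ∷ xs) = tape [] (just x) (map just xs)

untilBlank : ∀ {Γ : Set} → List (Maybe Γ) → List Γ
untilBlank []             = []
untilBlank (nothing ∷ _)  = []
untilBlank (just x ∷ cs)  = x ∷ untilBlank cs

-- The content from the head, rightwards, up to the first blank.

contents : ∀ {Γ : Set} → Tape Γ → List Γ
contents t = untilBlank (scanned t ∷ after t)

-- The tape alphabet extends S with finitely many work symbols.  Tape 0
-- carries the input and, after halting, the output; the machine halts where
-- δ is undefined.

record TM (S : Set) : Set where
  field
    workTapes   : ℕ
    workSymbols : ℕ
    states      : ℕ

  Γ : Set
  Γ = S ⊎ Fin workSymbols

  field
    start : Fin states
    δ     : Fin states → Vec (Maybe Γ) (suc workTapes) →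
            Maybe (Fin states × Vec (Maybe Γ × Move) (suc workTapes))

  Config : Set
  Config = Fin states × Vec (Tape Γ) (suc workTapes)

  initial : List S → Config
  initial xs = start , written (map inj₁ xs) Vec.∷ Vec.replicate workTapes blankTape

  step : Config → Maybe Config
  step (q , ts) =
    Maybe.map (λ (q′ , as) → q′ , Vec.zipWith act ts as) (δ q (Vec.map scanned ts))

  data HaltsIn : ℕ → Config → Config → Set where
    halt : ∀ {c} → step c ≡ nothing → HaltsIn zero c c
    next : ∀ {n c c′ c″} → step c ≡ just c′ → HaltsIn n c′ c″ → HaltsIn (suc n) c c″

  Computes_to_within_ : List S → List S → ℕ → Set
  Computes xs to ys within bound =
    ∃[ n ] ∃[ c ] n ≤ bound × HaltsIn n (initial xs) c
      × contents (Vec.head (proj₂ c)) ≡ map inj₁ ys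

------------------------------------------------------------------------
-- Polynomial-time functions and reductions

-- Only encodings of elements of X are required to be handled.

PolyTime : {S : Set} {X : Set a} {Y : Set b} →
           (X → List S) → (Y → List S) → (X → Y) → Set a
PolyTime {S = S} {X = X} encX encY f =
  Σ[ M ∈ TM S ] ∃[ c ] ∃[ d ] ((x : X) →
    TM.Computes_to_within_ M (encX x) (encY (f x)) (c * length (encX x) ^ d + c))

record Problem (S : Set) (i ℓ : Level) : Set (lsuc (i ⊔ˡ ℓ)) where
  field
    Instance : Set i
    encode   : Instance → List S
    Positive : Instance → Set ℓ

infix 4 _≤ₚ_

_≤ₚ_ : {S : Set} → Problem S i ℓ → Problem S j ℓ′ → Set (i ⊔ˡ j ⊔ˡ ℓ ⊔ˡ ℓ′)
P ≤ₚ Q = Σ[ f ∈ (P.Instance → Q.Instance) ]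
           PolyTime P.encode Q.encode f
         × (∀ x → P.Positive x ⇔ Q.Positive (f x))
  where
  module P = Problem P
  module Q = Problem Q

------------------------------------------------------------------------
-- Encodings

data Token (k : ℕ) : Set where
  letter                     : Fin k → Token k
  tick comma hash            : Token k
  ∅ᵗ εᵗ charᵗ ∪ᵗ ∙ᵗ ⋆ᵗ       : Token k

encℕ : ℕ → List (Token k)
encℕ n = replicate n tick

encWord : Word k → List (Token k)
encWord = map letter

encTuple : List (Word k) → List (Token k)
encTuple = concatMap (λ w → encWord w ++ [ comma ])

-- Prefix notation.

encRegex : Regex k → List (Token k)
encRegex ∅        = [ ∅ᵗ ]
encRegex ε        = [ εᵗ ]
encRegex (char c) = charᵗ ∷ letter c ∷ []
encRegex (r ∪ s)  = ∪ᵗ ∷ encRegex r ++ encRegex s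
encRegex (r ∙ s)  = ∙ᵗ ∷ encRegex r ++ encRegex s
encRegex (r ⋆)    = ⋆ᵗ ∷ encRegex r

-- The labels of the vertices in order, then the edges; vertex numbers are in
-- unary, which is polynomial in the size since every vertex has a label.

encDAG : DAG k → List (Token k)
encDAG G = encWord (tabulate label) ++ hash ∷ concatMap encEdge edges
  where
  open DAG G
  encEdge : Fin size × Fin size → List (Token _)
  encEdge (u , v) = encℕ (toℕ u) ++ comma ∷ encℕ (toℕ v) ++ [ comma ]

-- Pairs of a regular expression of the family and an input.  Membership in
-- the family is a promise and is not part of the encoding.

With : RegularFamily k ℓ → Set → Set ℓ
With 𝒦 X = Σ (Regex _) 𝒦 × X

encWith : {𝒦 : RegularFamily k ℓ} {X : Set} →
          (X → List (Token k)) → With 𝒦 X → List (Token k)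
encWith encX ((r , _) , x) = encRegex r ++ hash ∷ encX x

------------------------------------------------------------------------
-- Constrained topological sort and constrained shuffle

CTS : Language k ℓ → Problem (Token k) 0ℓ ℓ
CTS {k = k} K = record
  { Instance = DAG k
  ; encode   = encDAG
  ; Positive = λ G → ∃[ σ ] IsTopologicalSort G σ × K (sortedWord G σ)
  }

CSh : Language k ℓ → Problem (Token k) 0ℓ ℓ
CSh {k = k} K = record
  { Instance = List (Word k)
  ; encode   = encTuple
  ; Positive = λ U → ∃[ w ] Shuffle U w × K w
  }

CTSᶠ : RegularFamily k ℓ → Problem (Token k) ℓ 0ℓ
CTSᶠ {k = k} 𝒦 = record
  { Instance = With 𝒦 (DAG k)
  ; encode   = encWith encDAG
  ; Positive = λ ((r , _) , G) → Problem.Positive (CTS ⟦ r ⟧) G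
  }

CShᶠ : RegularFamily k ℓ → Problem (Token k) ℓ 0ℓ
CShᶠ {k = k} 𝒦 = record
  { Instance = With 𝒦 (List (Word k))
  ; encode   = encWith encTuple
  ; Positive = λ ((r , _) , U) → Problem.Positive (CSh ⟦ r ⟧) U
  }

------------------------------------------------------------------------
-- Shuffle reductions

IsFilterSequence : Language k ℓ → Language k ℓ′ → (ℕ → Word k) → Set (ℓ ⊔ˡ ℓ′)
IsFilterSequence K K′ f =
  ∀ n v → length v ≡ n → K v ⇔ (∃[ w ] Interleaving v (f n) w × K′ w)

ShuffleReduces : Language k ℓ → Language k ℓ′ → Set (ℓ ⊔ˡ ℓ′)
ShuffleReduces K K′ =
  ∃[ f ] IsFilterSequence K K′ f × PolyTime encℕ encWord f

FamilyShuffleReduces : RegularFamily k ℓ → Language k ℓ′ → Set (ℓ ⊔ˡ ℓ′)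
FamilyShuffleReduces {k = k} 𝒦 K′ =
    (∀ r → 𝒦 r → ShuffleReduces ⟦ r ⟧ K′)
  × (Σ[ f ∈ (With 𝒦 ℕ → Word k) ]
       (∀ r (r∈𝒦 : 𝒦 r) → IsFilterSequence ⟦ r ⟧ K′ (λ n → f ((r , r∈𝒦) , n)))
     × PolyTime (encWith encℕ) encWord f)

{-# OPTIONS --safe #-}

-- Given a DAG G with n vertices, add to it a disjoint directed path spelling the
-- filter word f_n: the topological sorts of the new DAG are exactly the
-- interleavings of a topological sort of G with the path, so by the filter property
-- one of them spells a word of K′ iff some topological sort of G spells a word of K.
-- For shuffles, f_n is simply added to the tuple, n being its total length.
--
-- The machine computing either reduction writes the regular expression and n in
-- unary on the input tape of the given machine M for (K, n) ↦ f_n, runs M on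
-- separate tapes, and assembles the output.  The output of M is no longer than its
-- input plus its running time, so everything stays polynomial.

module Submission where

open import Defs
open import Data.Bool.Base using (Bool; true; false; if_then_else_)
open import Data.Fin.Base
  using (Fin; zero; suc; toℕ; _<_; _↑ˡ_; _↑ʳ_; splitAt; join; inject₁)
open import Data.Fin.Patterns using (0F; 1F; 2F; 3F; 4F; 5F)
open import Data.Fin.Permutation
  using (Permutation′; Permutation; permutation; _⟨$⟩ʳ_; _⟨$⟩ˡ_; inverseˡ; inverseʳ; ↔⇒≡)
open import Data.Fin.Properties
  using ( +↔⊎; 1↔⊤; 2↔Bool; toℕ-↑ˡ; toℕ-↑ʳ; toℕ-inject₁; toℕ-injective; <-cmp
        ; splitAt-↑ˡ; splitAt-↑ʳ; splitAt-join; join-splitAt )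
open import Data.List.Base
  using ( List; []; _∷_; [_]; _++_; _ʳ++_; map; concat; concatMap; drop; length; lookup
        ; replicate; reverse; tabulate )
open import Data.List.Membership.Propositional using (_∈_)
open import Data.List.Membership.Propositional.Properties
  using (∈-map⁻; ∈-map⁺; ∈-++⁻; ∈-++⁺ˡ; ∈-++⁺ʳ; ∈-tabulate⁻; ∈-tabulate⁺)
open import Data.List.Properties
  using ( ∷-injective; ++-assoc; ++-identityʳ; ++-ʳ++; ʳ++-defn; concatMap-++; concatMap-cong
        ; concatMap-map; length-++; length-++-≤ˡ; length-++-≤ʳ; length-drop; length-map
        ; length-replicate; length-reverse; length-tabulate; map-++; map-tabulate; reverse-++
        ; reverse-involutive; reverse-map; tabulate-cong; tabulate-lookup; unfold-reverse )
open import Data.List.Relation.Ternary.Interleaving.Propositional as Interleaving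
  using (Interleaving; []; consˡ; consʳ)
open import Data.List.Relation.Ternary.Interleaving.Properties using (interleave-length)
open import Data.List.Relation.Unary.All as All using (All; []; _∷_)
import Data.List.Relation.Unary.All.Properties as All
open import Data.Maybe.Base as Maybe using (Maybe; just; nothing; is-just; maybe′)
open import Data.Nat.Base
  using (ℕ; zero; suc; pred; _+_; _∸_; _*_; _^_; _≤_; z≤n; s≤s)
  renaming (_<_ to _<ℕ_)
open import Data.Nat.Properties hiding (<-cmp)
open import Data.Product.Base using (Σ-syntax; ∃-syntax; _×_; _,_; proj₁; proj₂; map₁)
open import Data.Sum.Base as Sum using (_⊎_; inj₁; inj₂; [_,_]′)
open import Data.Sum.Function.Propositional using (_⊎-↔_)
open import Data.Sum.Properties using (inj₁-injective; inj₂-injective; [,]-map; map-map)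
open import Data.Unit.Base using (⊤; tt)
open import Data.Vec.Base as Vec using (Vec; []; _∷_; _[_]≔_)
import Data.Vec.Functional as Vector
open import Function.Base using (_∘_; id)
open import Function.Bundles using (_⇔_; mk⇔; Equivalence; _↔_; Inverse)
open import Function.Construct.Composition using (_↔-∘_)
open import Function.Construct.Identity using (↔-id)
open import Level using (Level)
open import Relation.Binary.Construct.Closure.Transitive using (TransClosure; _∷_)
open import Relation.Binary.Definitions using (tri<; tri≈; tri>)
open import Relation.Binary.PropositionalEquality
  using (_≡_; refl; sym; trans; cong; cong₂; subst; subst₂; module ≡-Reasoning)
open import Relation.Nullary.Negation using (¬_; contradiction)

-- Two obstacles shape the proof. A `Tape` lists its cells explicitly, so a tape with one more
-- listed blank is a different configuration. The programs are therefore written in a small language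
-- with composable step bounds, and the input of `M` is laid out so that its tapes are literally
-- those of `TM.initial`. No arithmetic is performed on tapes: `n` is the number of letters in the
-- input, produced as ticks while these letters are copied, and the copied labels later serve as the
-- unary counter that numbers the vertices of the path. On the combinatorial side, a topological
-- sort of the enlarged DAG is at first just a permutation of all its vertices. It is factored into
-- a mask, a permutation of the old vertices and a permutation of the path. The path edges force the
-- last one to be increasing, hence the identity, so that the path really spells the filter word.

private variable
  ℓ ℓ′ : Level
  A B : Set
  k m n p : ℕ

-- Multi-tape programs

-- States form any type in bijection with some `Fin`, so that sequencing and loops can use sums of
-- state types; `toTM` numbers them at the end.
record Machine (C : Set) (N : ℕ) : Set₁ where
  field
    State     : Set
    {#states} : ℕ
    finite    : Fin #states ↔ State
    start     : State
    δ         : State → Vec C N → Maybe (State × Vec (C × Move) N)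

module _ {Γ : Set} where

  keep : ∀ {n} → Vec (Maybe Γ) n → Vec (Maybe Γ × Move) n
  keep = Vec.map (_, stay)

  act-stay : (t : Tape Γ) → act t (scanned t , stay) ≡ t
  act-stay (tape []      _ _) = refl
  act-stay (tape (_ ∷ _) _ _) = refl

  zipWith-act-keep : ∀ {n} (ts : Vec (Tape Γ) n) →
                     Vec.zipWith act ts (keep (Vec.map scanned ts)) ≡ ts
  zipWith-act-keep []       = refl
  zipWith-act-keep (t ∷ ts) = cong₂ _∷_ (act-stay t) (zipWith-act-keep ts)

  zipWith-act-≔ : ∀ {n} (ts : Vec (Tape Γ) n) as i a →
                  Vec.zipWith act ts (as [ i ]≔ a) ≡
                  Vec.zipWith act ts as [ i ]≔ act (Vec.lookup ts i) a
  zipWith-act-≔ (t ∷ ts) (b ∷ as) zero    a = refl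
  zipWith-act-≔ (t ∷ ts) (b ∷ as) (suc i) a = cong (_ ∷_) (zipWith-act-≔ ts as i a)

module _ {Γ : Set} {N : ℕ} where

  private
    C : Set
    C = Maybe Γ

    Tapes : Set
    Tapes = Vec (Tape Γ) N

  module _ (A : Machine C N) where
    open Machine A

    -- The number is an upper bound on the number of steps.
    data HaltsFrom : State → Tapes → ℕ → Tapes → Set where
      stop : ∀ {q ts n} → δ q (Vec.map scanned ts) ≡ nothing → HaltsFrom q ts n ts
      next : ∀ {q q′ ts as n ts′} → δ q (Vec.map scanned ts) ≡ just (q′ , as) →
             HaltsFrom q′ (Vec.zipWith act ts as) n ts′ → HaltsFrom q ts (suc n) ts′

  weaken : ∀ {A q ts m n ts′} → m ≤ n → HaltsFrom A q ts m ts′ → HaltsFrom A q ts n ts′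
  weaken _         (stop e)   = stop e
  weaken (s≤s m≤n) (next e r) = next e (weaken m≤n r)

  Update : Set
  Update = Fin N × C × Move

  actions : List Update → Vec C N → Vec (C × Move) N
  actions []             cs = keep cs
  actions ((i , a) ∷ us) cs = actions us cs [ i ]≔ a

  -- Every update reads `ts₀`, the tapes before the step, because all heads act simultaneously. On
  -- an explicit list of tapes this computes, which lets most single steps below be checked by
  -- `refl`.
  effect : List Update → Tapes → Tapes → Tapes
  effect []             ts₀ ts = ts
  effect ((i , a) ∷ us) ts₀ ts = effect us ts₀ ts [ i ]≔ act (Vec.lookup ts₀ i) a

  zipWith-act-actions : ∀ us ts →
                        Vec.zipWith act ts (actions us (Vec.map scanned ts)) ≡ effect us ts ts
  zipWith-act-actions []             ts = zipWith-act-keep ts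
  zipWith-act-actions ((i , a) ∷ us) ts =
    trans (zipWith-act-≔ ts (actions us _) i a)
          (cong (_[ i ]≔ _) (zipWith-act-actions us ts))

  infixr 4 _⨾_

  -- once, sweep and while look only at the cell scanned on the given tape; sweep
  -- repeats a single step as long as it is defined.
  data Program : Set₁ where
    machine : Machine C N → Program
    _⨾_     : Program → Program → Program
    once    : Fin N → (C → List Update) → Program
    sweep   : Fin N → (C → Maybe (List Update)) → Program
    while   : Fin N → (C → Bool) → Program → Program

  compile : Program → Machine C N
  compile (machine A) = A
  -- Where P would halt, Q already makes its first step.
  compile (P ⨾ Q) = record
    { State  = P.State ⊎ Q.State
    ; finite = (P.finite ⊎-↔ Q.finite) ↔-∘ +↔⊎
    ; start  = inj₁ P.start
    ; δ      = λ where
        (inj₁ q) cs → maybe′ (λ (q′ , as) → just (inj₁ q′ , as))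
                             (Maybe.map (map₁ inj₂) (Q.δ Q.start cs)) (P.δ q cs)
        (inj₂ q) cs → Maybe.map (map₁ inj₂) (Q.δ q cs)
    }
    where
    module P = Machine (compile P)
    module Q = Machine (compile Q)
  compile (once i f) = record
    { State  = Bool
    ; finite = 2↔Bool
    ; start  = false
    ; δ      = λ where
        false cs → just (true , actions (f (Vec.lookup cs i)) cs)
        true  cs → nothing
    }
  compile (sweep i f) = record
    { State  = ⊤
    ; finite = 1↔⊤
    ; start  = tt
    ; δ      = λ _ cs → Maybe.map (λ us → tt , actions us cs) (f (Vec.lookup cs i))
    }
  compile (while i p P) = record
    { State  = ⊤ ⊎ P.State
    ; finite = (1↔⊤ ⊎-↔ P.finite) ↔-∘ +↔⊎
    ; start  = inj₁ tt
    ; δ      = λ where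
        (inj₁ _) cs → if p (Vec.lookup cs i) then just (inj₂ P.start , keep cs) else nothing
        (inj₂ q) cs → maybe′ (λ (q′ , as) → just (inj₂ q′ , as))
                             (just (inj₁ tt , keep cs)) (P.δ q cs)
    }
    where module P = Machine (compile P)

  -- A record and not a synonym, so that `P` can be read off the type; `compile P` alone would not
  -- determine it.
  record Halts (P : Program) (ts : Tapes) (n : ℕ) (ts′ : Tapes) : Set where
    constructor halts
    field run : HaltsFrom (compile P) (Machine.start (compile P)) ts n ts′

  module _ {P Q : Program} where

    ⨾-second : ∀ {q ts n ts′} → HaltsFrom (compile Q) q ts n ts′ →
               HaltsFrom (compile (P ⨾ Q)) (inj₂ q) ts n ts′
    ⨾-second (stop e)   = stop (cong (Maybe.map _) e)
    ⨾-second (next e r) = next (cong (Maybe.map _) e) (⨾-second r)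

    -- The handover costs nothing: the step that `P` leaves undefined is already the first step of
    -- `Q`, or the whole program halts there if `Q` does. So the bounds simply add up.
    ⨾-first : ∀ {q ts m ts′ n ts″} → HaltsFrom (compile P) q ts m ts′ → Halts Q ts′ n ts″ →
              HaltsFrom (compile (P ⨾ Q)) (inj₁ q) ts (m + n) ts″
    ⨾-first {m = m} (stop e) (halts (stop e′)) =
      stop (trans (cong (maybe′ _ _) e) (cong (Maybe.map _) e′))
    ⨾-first {m = m} (stop e) (halts (next {n = n} e′ r)) =
      weaken (m≤n+m (suc n) m)
        (next (trans (cong (maybe′ _ _) e) (cong (Maybe.map _) e′)) (⨾-second r))
    ⨾-first (next e r) r′ = next (cong (maybe′ _ _) e) (⨾-first r r′)

    infixr 4 _then_

    _then_ : ∀ {ts m ts′ n ts″} → Halts P ts m ts′ → Halts Q ts′ n ts″ →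
             Halts (P ⨾ Q) ts (m + n) ts″
    halts r then r′ = halts (⨾-first r r′)

  once-halts : ∀ {i f ts ts′} →
               effect (f (Vec.lookup (Vec.map scanned ts) i)) ts ts ≡ ts′ →
               Halts (once i f) ts 1 ts′
  once-halts {i} {f} {ts} refl = halts (next refl (subst
    (HaltsFrom (compile (once i f)) true _ 0)
    (zipWith-act-actions (f (Vec.lookup (Vec.map scanned ts) i)) ts) (stop refl)))

  sweep-step : ∀ {i f ts us ts′ n ts″} →
               f (Vec.lookup (Vec.map scanned ts) i) ≡ just us → effect us ts ts ≡ ts′ →
               Halts (sweep i f) ts′ n ts″ → Halts (sweep i f) ts (suc n) ts″
  sweep-step {i} {f} {ts} {us} {n = n} {ts″} e refl (halts r) =
    halts (next (cong (Maybe.map _) e)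
      (subst (λ t → HaltsFrom (compile (sweep i f)) tt t n ts″)
             (sym (zipWith-act-actions us ts)) r))

  sweep-stop : ∀ {i f ts} → f (Vec.lookup (Vec.map scanned ts) i) ≡ nothing →
               Halts (sweep i f) ts 0 ts
  sweep-stop e = halts (stop (cong (Maybe.map _) e))

  module _ {i : Fin N} {p : C → Bool} {P : Program} where

    while-stop : ∀ {ts} → p (Vec.lookup (Vec.map scanned ts) i) ≡ false →
                 Halts (while i p P) ts 0 ts
    while-stop e = halts (stop (cong (if_then _ else nothing) e))

    while-body : ∀ {q ts m ts′ n ts″} → HaltsFrom (compile P) q ts m ts′ →
                 Halts (while i p P) ts′ n ts″ →
                 HaltsFrom (compile (while i p P)) (inj₂ q) ts (suc (m + n)) ts″
    while-body {m = m} {ts′} {n} {ts″} (stop e) (halts r) =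
      weaken (s≤s (m≤n+m n m)) (next (cong (maybe′ _ _) e)
        (subst (λ t → HaltsFrom (compile (while i p P)) (inj₁ tt) t n ts″)
               (sym (zipWith-act-keep ts′)) r))
    while-body (next e r) r′ = next (cong (maybe′ _ _) e) (while-body r r′)

    -- The two additional steps enter the body and return to the test.
    while-step : ∀ {ts m ts′ n ts″} → p (Vec.lookup (Vec.map scanned ts) i) ≡ true →
                 Halts P ts m ts′ → Halts (while i p P) ts′ n ts″ →
                 Halts (while i p P) ts (2 + (m + n)) ts″
    while-step {ts} {m} {n = n} {ts″} e (halts r) r′ =
      halts (next (cong (if_then _ else nothing) e)
        (subst (λ t → HaltsFrom (compile (while i p P)) (inj₂ _) t (suc (m + n)) ts″)
               (sym (zipWith-act-keep ts)) (while-body r r′)))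

-- Translation of programs into Turing machines

module _ {S : Set} {workSymbols workTapes : ℕ} where

  toTM : Machine (Maybe (S ⊎ Fin workSymbols)) (suc workTapes) → TM S
  toTM A = record
    { workTapes   = workTapes
    ; workSymbols = workSymbols
    ; states      = #states
    ; start       = Inverse.from finite start
    ; δ           = λ q cs → Maybe.map (map₁ (Inverse.from finite)) (δ (Inverse.to finite q) cs)
    }
    where open Machine A

  module _ (A : Machine (Maybe (S ⊎ Fin workSymbols)) (suc workTapes)) where
    open Machine A
    open TM (toTM A) using (step; HaltsIn; halt; next)

    step-toTM : ∀ q ts → step (Inverse.from finite q , ts) ≡
                Maybe.map (λ (q′ , as) → Inverse.from finite q′ , Vec.zipWith act ts as)
                          (δ q (Vec.map scanned ts))
    step-toTM q ts rewrite Inverse.inverseˡ finite {q} refl with δ q (Vec.map scanned ts)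
    ... | nothing = refl
    ... | just _  = refl

    toTM-halts : ∀ {q ts n ts′} → HaltsFrom A q ts n ts′ →
                 ∃[ m ] ∃[ q′ ] m ≤ n × HaltsIn m (Inverse.from finite q , ts) (q′ , ts′)
    toTM-halts {q} {ts} (stop e) =
      0 , _ , z≤n , halt (trans (step-toTM q ts) (cong (Maybe.map _) e))
    toTM-halts {q} {ts} (next e r) with m , q′ , m≤n , h ← toTM-halts r =
      suc m , q′ , s≤s m≤n , next (trans (step-toTM q ts) (cong (Maybe.map _) e)) h

-- The programs of the two reductions

All-ʳ++⁺ : ∀ {A : Set} {P : A → Set} {xs ys} → All P xs → All P ys → All P (xs ʳ++ ys)
All-ʳ++⁺ []       qs = qs
All-ʳ++⁺ (p ∷ ps) qs = All-ʳ++⁺ ps (p ∷ qs)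

notHash : Token k → Bool
notHash hash = false
notHash _    = true

NoHash : List (Token k) → Set
NoHash = All (λ x → notHash x ≡ true)

isLetter : Token k → Bool
isLetter (letter _) = true
isLetter _          = false

-- Recovers the index of the filter word from the input: labels are encoded by letters only, and the
-- commas of a tuple must not count.
letters : List (Token k) → ℕ
letters []       = 0
letters (x ∷ xs) = if isLetter x then suc (letters xs) else letters xs

letters-ʳ++ : ∀ (xs : List (Token k)) {ys} → letters (xs ʳ++ ys) ≡ letters xs + letters ys
letters-ʳ++ []       = refl
letters-ʳ++ (x ∷ xs) {ys} with isLetter x | letters-ʳ++ xs {x ∷ ys}
... | true  | e = trans e (+-suc (letters xs) (letters ys))
... | false | e = e

letters-reverse : ∀ (xs : List (Token k)) → letters (reverse xs) ≡ letters xs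
letters-reverse xs = trans (letters-ʳ++ xs) (+-identityʳ _)

-- The edges of a path on b + 1 vertices numbered from j on are pathTokens j b.
edgeTokens : ℕ → List (Token k)
edgeTokens j = encℕ j ++ comma ∷ encℕ (suc j) ++ [ comma ]

pathTokens : ℕ → ℕ → List (Token k)
pathTokens j zero    = []
pathTokens j (suc b) = edgeTokens j ++ pathTokens (suc j) b

-- Tapes, and the number of cells a run can reach

module _ {Γ : Set} where

  -- The left end of the tape reads as a blank in back, its right end in front.
  back : List (Maybe Γ) → List (Maybe Γ) → Tape Γ
  back []       rs = tape [] nothing rs
  back (c ∷ ls) rs = tape ls c rs

  front : List (Maybe Γ) → List (Maybe Γ) → Tape Γ
  front ls []       = tape ls nothing []
  front ls (c ∷ rs) = tape ls c rs

  act-left : ∀ {ls c rs} x → act (tape ls c rs) (x , left) ≡ back ls (x ∷ rs)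
  act-left {[]}    _ = refl
  act-left {_ ∷ _} _ = refl

  act-right : ∀ {ls c} rs x → act (tape ls c rs) (x , right) ≡ front (x ∷ ls) rs
  act-right {[]}    []      _ = refl
  act-right {[]}    (_ ∷ _) _ = refl
  act-right {_ ∷ _} []      _ = refl
  act-right {_ ∷ _} (_ ∷ _) _ = refl

  -- Explicit blanks count too. The sum then grows only when the head leaves the listed cells, hence
  -- by at most one per step.
  extent : Tape Γ → ℕ
  extent t = length (before t) + length (after t)

  extent-act : ∀ t a → extent (act t a) ≤ suc (extent t)
  extent-act (tape []       _ rs)       (c , left)  = ≤-refl
  extent-act (tape (l ∷ ls) _ rs)       (c , left)  =
    ≤-trans (≤-reflexive (+-suc (length ls) (length rs))) (n≤1+n _)
  extent-act (tape []       _ rs)       (c , stay)  = n≤1+n _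
  extent-act (tape (_ ∷ _)  _ rs)       (c , stay)  = n≤1+n _
  extent-act (tape []       _ [])       (c , right) = ≤-refl
  extent-act (tape (_ ∷ _)  _ [])       (c , right) = ≤-refl
  extent-act (tape []       _ (r ∷ rs)) (c , right) = n≤1+n _
  extent-act (tape (l ∷ ls) _ (r ∷ rs)) (c , right) =
    s≤s (≤-trans (≤-reflexive (sym (+-suc (length ls) (length rs)))) (n≤1+n _))

  length-untilBlank : ∀ (cs : List (Maybe Γ)) → length (untilBlank cs) ≤ length cs
  length-untilBlank []             = z≤n
  length-untilBlank (nothing ∷ cs) = z≤n
  length-untilBlank (just x ∷ cs)  = s≤s (length-untilBlank cs)

  length-contents : ∀ (t : Tape Γ) → length (contents t) ≤ suc (extent t)
  length-contents t = ≤-trans (length-untilBlank (scanned t ∷ after t))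
    (s≤s (m≤n+m (length (after t)) (length (before t))))

  extent-written : ∀ xs → extent (written {Γ} xs) ≤ length xs
  extent-written []       = z≤n
  extent-written (x ∷ xs) = ≤-trans (≤-reflexive (length-map just xs)) (n≤1+n _)

module _ {S : Set} (M : TM S) where
  open TM M

  extent-halts : ∀ {n c c′} → HaltsIn n c c′ →
                 extent (Vec.head (proj₂ c′)) ≤ n + extent (Vec.head (proj₂ c))
  extent-halts (halt _) = ≤-refl
  extent-halts {suc n} (next {c = q , t ∷ ts} e h)
    with δ q (Vec.map scanned (t ∷ ts)) | e
  ... | just (_ , a ∷ _) | refl = begin
    _                        ≤⟨ extent-halts h ⟩
    n + extent (act t a)     ≤⟨ +-monoʳ-≤ n (extent-act t a) ⟩
    n + suc (extent t)       ≡⟨ +-suc n (extent t) ⟩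
    suc (n + extent t)       ∎
    where open ≤-Reasoning

  length-result : ∀ {xs ys b} → Computes xs to ys within b → length ys ≤ suc (b + length xs)
  length-result {xs} {ys} {b} (n , (q , ts) , n≤b , h , e) = begin
    length ys                            ≡⟨ length-map inj₁ ys ⟨
    length (map inj₁ ys)                 ≡⟨ cong length e ⟨
    length (contents (Vec.head ts))      ≤⟨ length-contents (Vec.head ts) ⟩
    suc (extent (Vec.head ts))           ≤⟨ s≤s (extent-halts h) ⟩
    suc (n + extent (written (map inj₁ xs)))
      ≤⟨ s≤s (+-mono-≤ n≤b (≤-trans (extent-written (map inj₁ xs))
                              (≤-reflexive (length-map inj₁ xs)))) ⟩
    suc (b + length xs)                  ∎
    where open ≤-Reasoning

module Programs (M : TM (Token k)) where

  open TM M using (Γ; workTapes; HaltsIn; halt; next; Computes_to_within_)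

  Cell : Set
  Cell = Maybe Γ

  N : ℕ
  N = 6 + workTapes

  Prog : Set₁
  Prog = Program {Γ} {N}

  Instr : Set
  Instr = Update {Γ} {N}

  pattern tok x = just (inj₁ x)

  cells : List (Token k) → List Cell
  cells xs = map just (map inj₁ xs)

  -- Cells to the left of the head are listed from right to left.
  emit : List (Token k) → List Cell → List Cell
  emit xs ls = cells xs ʳ++ ls

  cells-++ : ∀ xs ys → cells (xs ++ ys) ≡ cells xs ++ cells ys
  cells-++ xs ys = trans (cong (map just) (map-++ inj₁ xs ys)) (map-++ just (map inj₁ xs) _)

  cells-reverse : ∀ xs → cells (reverse xs) ≡ reverse (cells xs)
  cells-reverse xs =
    trans (cong (map just) (reverse-map inj₁ xs)) (reverse-map just (map inj₁ xs))

  emit-++ : ∀ xs ys ls → emit (xs ++ ys) ls ≡ emit ys (emit xs ls)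
  emit-++ xs ys ls = trans (cong (_ʳ++ ls) (cells-++ xs ys)) (++-ʳ++ (cells xs))

  emit≡reverse : ∀ xs ls → emit xs ls ≡ cells (reverse xs) ++ ls
  emit≡reverse xs ls = trans (ʳ++-defn (cells xs)) (cong (_++ ls) (sym (cells-reverse xs)))

  emit-reverse : ∀ xs ls → emit (reverse xs) ls ≡ cells xs ++ ls
  emit-reverse xs ls =
    trans (emit≡reverse (reverse xs) ls) (cong (λ ys → cells ys ++ ls) (reverse-involutive xs))

  written≡front : ∀ xs → written {Γ} (map inj₁ xs) ≡ front [] (cells xs)
  written≡front []       = refl
  written≡front (x ∷ xs) = refl

  contents-front : ∀ ls xs → contents (front ls (cells xs ++ [ nothing ])) ≡ map inj₁ xs
  contents-front ls []       = refl
  contents-front ls (x ∷ xs) = cong (inj₁ x ∷_) (go xs)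
    where
    go : ∀ xs → untilBlank (cells xs ++ [ nothing ]) ≡ map inj₁ xs
    go []       = refl
    go (x ∷ xs) = cong (inj₁ x ∷_) (go xs)

  append : ∀ (ls : List Cell) x →
           act (tape ls nothing []) (x , right) ≡ tape (x ∷ ls) nothing []
  append ls x = act-right [] x

  machineM : Machine Cell N
  machineM = record
    { State  = Fin (TM.states M)
    ; finite = ↔-id _
    ; start  = TM.start M
    ; δ      = λ where
        q (c₀ ∷ c₁ ∷ c₂ ∷ c₃ ∷ c₄ ∷ cs) →
          Maybe.map (λ (q′ , as) → q′ , keep (c₀ ∷ c₁ ∷ c₂ ∷ c₃ ∷ c₄ ∷ []) Vec.++ as)
                    (TM.δ M q cs)
    }

  act-left-back : ∀ xs {rs x} →
    act (back (cells xs) rs) (x , left) ≡ back (cells (drop 1 xs)) (x ∷ rs)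
  act-left-back []       = refl
  act-left-back (x ∷ xs) = act-left _

  runM-halts : ∀ {t₀ t₁ t₂ t₃ t₄ : Tape Γ} {n c c′} → HaltsIn n c c′ →
               HaltsFrom machineM (proj₁ c) (t₀ ∷ t₁ ∷ t₂ ∷ t₃ ∷ t₄ ∷ proj₂ c) n
                                        (t₀ ∷ t₁ ∷ t₂ ∷ t₃ ∷ t₄ ∷ proj₂ c′)
  runM-halts {c = q , ts} (halt e) with TM.δ M q (Vec.map scanned ts) in eq
  ... | nothing = stop (cong (Maybe.map _) eq)
  runM-halts {t₀} {t₁} {t₂} {t₃} {t₄} {suc n} {q , ts} {c′} (next e h)
    with TM.δ M q (Vec.map scanned ts) in eq | e
  ... | just (q′ , as) | refl = next (cong (Maybe.map _) eq)
    (subst (λ ts′ → HaltsFrom machineM q′ (ts′ Vec.++ Vec.zipWith act ts as) n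
                      (t₀ ∷ t₁ ∷ t₂ ∷ t₃ ∷ t₄ ∷ proj₂ c′))
      (sym (zipWith-act-keep (t₀ ∷ t₁ ∷ t₂ ∷ t₃ ∷ t₄ ∷ []))) (runM-halts h))

  -- Tape 0 is the input and output, tape 1 receives the labels (or the words),
  -- tape 2 the filter word, tape 3 a copy of the input, tape 4 the edges;
  -- the tapes of M start at tape 5.

  copyRight : Fin N → List (Fin N) → Prog
  copyRight i js = sweep i λ where
    nothing  → nothing
    (just x) → just (map (_, just x , right) (i ∷ js))

  write : Token k → Instr
  write x = 0F , tok x , right

  always : List Instr → Prog
  always us = once 0F (λ _ → us)

  copy-input : ∀ xs ls ls′ {t₁ t₂ t₄ us} →
    Halts (copyRight 0F [ 3F ])
      (front ls (cells xs) ∷ t₁ ∷ t₂ ∷ tape ls′ nothing [] ∷ t₄ ∷ us) (length xs)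
      (tape (emit xs ls) nothing [] ∷ t₁ ∷ t₂ ∷ tape (emit xs ls′) nothing [] ∷ t₄ ∷ us)
  copy-input []       ls ls′ = sweep-stop refl
  copy-input (x ∷ xs) ls ls′ = sweep-step refl
    (cong₂ (λ s t → s ∷ _ ∷ _ ∷ t ∷ _) (act-right (cells xs) _) (append ls′ _))
    (copy-input xs _ _)

  copy-labels : ∀ xs ls ls′ {ts} →
    Halts (copyRight 1F [ 0F ])
      (tape ls nothing [] ∷ front ls′ (cells xs) ∷ ts) (length xs)
      (tape (emit xs ls) nothing [] ∷ tape (emit xs ls′) nothing [] ∷ ts)
  copy-labels []       ls ls′ = sweep-stop refl
  copy-labels (x ∷ xs) ls ls′ = sweep-step refl
    (cong₂ (λ s t → s ∷ t ∷ _) (append ls _) (act-right (cells xs) _))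
    (copy-labels xs _ _)

  copy-edges : ∀ xs ls ls′ {t₁ t₂ t₃ us} →
    Halts (copyRight 4F [ 0F ])
      (tape ls nothing [] ∷ t₁ ∷ t₂ ∷ t₃ ∷ front ls′ (cells xs) ∷ us) (length xs)
      (tape (emit xs ls) nothing [] ∷ t₁ ∷ t₂ ∷ t₃ ∷ tape (emit xs ls′) nothing [] ∷ us)
  copy-edges []       ls ls′ = sweep-stop refl
  copy-edges (x ∷ xs) ls ls′ = sweep-step refl
    (cong₂ (λ s t → s ∷ _ ∷ _ ∷ _ ∷ t ∷ _) (append ls _) (act-right (cells xs) _))
    (copy-edges xs _ _)

  -- Nothing is known about the tape of `M` beyond its output, and nothing has to be: the sweep
  -- stops at the first blank, just as `untilBlank` does, and the hypothesis excludes work symbols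
  -- before it.
  copy-filter : ∀ xs ls ls′ ls″ rs {t₁ t₃ t₄ us} → untilBlank rs ≡ map inj₁ xs →
    ∃[ t ] Halts (copyRight 5F (0F ∷ 2F ∷ []))
      (tape ls nothing [] ∷ t₁ ∷ tape ls′ nothing [] ∷ t₃ ∷ t₄ ∷ front ls″ rs ∷ us) (length xs)
      (tape (emit xs ls) nothing [] ∷ t₁ ∷ tape (emit xs ls′) nothing [] ∷ t₃ ∷ t₄ ∷ t ∷ us)
  copy-filter []       ls ls′ ls″ []             e = _ , sweep-stop refl
  copy-filter []       ls ls′ ls″ (nothing ∷ rs) e = _ , sweep-stop refl
  copy-filter (x ∷ xs) ls ls′ ls″ (just y ∷ rs)  e with refl , e′ ← ∷-injective e
    with t , h ← copy-filter xs (tok x ∷ ls) (tok x ∷ ls′) (tok x ∷ ls″) rs e′ =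
    t , sweep-step refl
      (cong₂ (λ { (r , s) t → r ∷ _ ∷ s ∷ _ ∷ _ ∷ t ∷ _ })
             (cong₂ _,_ (append ls _) (append ls′ _)) (act-right rs _)) h

  stashEdge : Cell → Maybe (List Instr)
  stashEdge nothing         = nothing
  stashEdge (just (inj₂ _)) = nothing
  stashEdge (tok x)         =
    if notHash x then just ((3F , tok x , left) ∷ (4F , tok x , left) ∷ []) else nothing

  stashEdge-tok : ∀ x → notHash x ≡ true →
    stashEdge (tok x) ≡ just ((3F , tok x , left) ∷ (4F , tok x , left) ∷ [])
  stashEdge-tok x p rewrite p = refl

  stashEdges : Prog
  stashEdges = sweep 3F stashEdge

  -- Reading leftwards up to the last `hash` and writing leftwards restores the order, and leaves
  -- the head of tape 4 on the blank just before the copy.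
  stash-edges : ∀ xs ls rs rs′ {t₀ t₁ t₂ us} → NoHash xs →
    Halts stashEdges
      (t₀ ∷ t₁ ∷ t₂ ∷ back (cells xs ++ tok hash ∷ ls) rs ∷ tape [] nothing rs′ ∷ us) (length xs)
      (t₀ ∷ t₁ ∷ t₂ ∷ tape ls (tok hash) (emit xs rs) ∷ tape [] nothing (emit xs rs′) ∷ us)
  stash-edges []       ls rs rs′ []       = sweep-stop refl
  stash-edges (x ∷ xs) ls rs rs′ (p ∷ ps) = sweep-step
    (stashEdge-tok x p)
    (cong (λ t → _ ∷ _ ∷ _ ∷ t ∷ _) (act-left _)) (stash-edges xs ls _ _ ps)

  stashLabel : Cell → Maybe (List Instr)
  stashLabel nothing         = nothing
  stashLabel (just (inj₂ _)) = nothing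
  stashLabel (tok x)         = if notHash x
    then just ((3F , tok x , left) ∷ (1F , tok x , left) ∷
               (if isLetter x then [ 5F , tok tick , left ] else []))
    else nothing

  stashLabel-tok : ∀ x {b} → notHash x ≡ true → isLetter x ≡ b →
    stashLabel (tok x) ≡ just ((3F , tok x , left) ∷ (1F , tok x , left) ∷
                               (if b then [ 5F , tok tick , left ] else []))
  stashLabel-tok x p refl rewrite p = refl

  stashLabels : Prog
  stashLabels = sweep 3F stashLabel

  -- Each letter moved to tape 1 also puts a `tick` on tape 5, so the unary index arises during the
  -- copy. The head of tape 5 is left on the blank where the `hash` of the input of `M` will go.
  stash-labels : ∀ xs n ls rs rs′ {t₀ t₂ t₄ us} → NoHash xs →
    ∃[ rs″ ] Halts stashLabels
      (t₀ ∷ tape [] nothing rs′ ∷ t₂ ∷ back (cells xs ++ tok hash ∷ ls) rs ∷ t₄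
          ∷ tape [] nothing (cells (encℕ n)) ∷ us) (length xs)
      (t₀ ∷ tape [] nothing (emit xs rs′) ∷ t₂ ∷ tape ls (tok hash) rs″ ∷ t₄
          ∷ tape [] nothing (cells (encℕ (letters xs + n))) ∷ us)
  stash-labels []       n ls rs rs′ []       = _ , sweep-stop refl
  stash-labels (x ∷ xs) n ls rs rs′ (p ∷ ps) with isLetter x in eq
  ... | true with rs″ , h ← stash-labels xs (suc n) ls (tok x ∷ rs) (tok x ∷ rs′) ps
                  rewrite +-suc (letters xs) n = rs″ , sweep-step
    (stashLabel-tok x p eq)
    (cong (λ t → _ ∷ _ ∷ _ ∷ t ∷ _) (act-left _)) h
  ... | false with rs″ , h ← stash-labels xs n ls (tok x ∷ rs) (tok x ∷ rs′) ps = rs″ , sweep-step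
    (stashLabel-tok x p eq)
    (cong (λ t → _ ∷ _ ∷ _ ∷ t ∷ _) (act-left _)) h

  -- The input of M is written from right to left, moving before each write, so
  -- that the tape ends up exactly in its initial form, without extra blanks.
  loadRegex : Prog
  loadRegex = while 3F is-just
    (once 5F (λ c → [ 5F , c , left ]) ⨾ once 3F (λ c → (3F , c , left) ∷ (5F , c , stay) ∷ []))

  -- Tape 5 always scans the last token written, here `y`, so no blank is ever listed at its left
  -- end. Four steps per token: one for each `once` and two for the loop.
  load-regex : ∀ xs y ys rs {t₀ t₁ t₂ t₄ us} →
    ∃[ t ] Halts loadRegex
      (t₀ ∷ t₁ ∷ t₂ ∷ back (cells xs) rs ∷ t₄ ∷ front [] (cells (y ∷ ys)) ∷ us) (length xs * 4)
      (t₀ ∷ t₁ ∷ t₂ ∷ t ∷ t₄ ∷ front [] (cells (xs ʳ++ (y ∷ ys))) ∷ us)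
  load-regex []       y ys rs = _ , while-stop refl
  load-regex (x ∷ xs) y ys rs {t₀} {t₁} {t₂} {t₄} {us}
    with t , h ← load-regex xs x (y ∷ ys) (tok x ∷ rs) =
    t , while-step refl
      (once-halts refl then
       once-halts (cong (λ t → _ ∷ _ ∷ _ ∷ t ∷ _) (act-left _))) h

  prepare : Prog
  prepare = stashLabels ⨾ always ((3F , nothing , left) ∷ (5F , tok hash , stay) ∷ []) ⨾
            loadRegex ⨾ machine machineM

  -- Common to both reductions: `ps` is the encoded tuple or the word of labels, and `xs` stands for
  -- whatever has been passed on tape 3 already, such as the edges.
  prepare-halts : ∀ rs ps xs {t₀ t₂ t₄ ys b} → NoHash ps →
    Computes rs ++ hash ∷ encℕ (letters ps) to ys within b →
    ∃[ t₃ ] ∃[ v ] ∃[ vs ] contents v ≡ map inj₁ ys × Halts prepare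
      (t₀ ∷ blankTape ∷ t₂ ∷ back (cells (reverse ps) ++ tok hash ∷ cells (reverse rs)) xs ∷ t₄
          ∷ blankTape ∷ Vec.replicate workTapes blankTape)
      (length ps + (1 + (length rs * 4 + b)))
      (t₀ ∷ tape [] nothing (cells ps) ∷ t₂ ∷ t₃ ∷ t₄ ∷ v ∷ vs)
  prepare-halts rs ps xs {t₀} {t₂} {t₄} {ys} {b} nh (n , (q , v ∷ vs) , n≤b , h , e)
    with rs″ , h₁ ← stash-labels (reverse ps) 0 (cells (reverse rs)) xs [] {t₀} {t₂} {t₄}
                      {Vec.replicate workTapes blankTape} (All-ʳ++⁺ nh [])
    rewrite +-identityʳ (letters (reverse ps)) | letters-reverse ps
          | emit-reverse ps [] | ++-identityʳ (cells ps)
          | length-reverse ps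
    with t₃ , h₃ ← load-regex (reverse rs) hash (encℕ (letters ps)) (nothing ∷ rs″)
                     {t₀} {tape [] nothing (cells ps)} {t₂} {t₄}
                     {Vec.replicate workTapes blankTape}
    rewrite ʳ++-defn (reverse rs) {hash ∷ encℕ (letters ps)} | reverse-involutive rs
          | length-reverse rs =
    t₃ , v , vs , e ,
    (h₁ then once-halts (cong (λ t → _ ∷ _ ∷ _ ∷ t ∷ _) (act-left _)) then h₃ then
     halts (weaken n≤b (runM-halts (subst (λ t → HaltsIn n (_ , t ∷ _) _) (written≡front _) h))))

  stepLeft : Cell → Maybe (List Instr)
  stepLeft nothing  = nothing
  stepLeft (just x) = just [ 0F , just x , left ]

  rewind : Prog
  rewind = always [ 0F , nothing , left ] ⨾
           sweep 0F stepLeft ⨾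
           always [ 0F , nothing , right ]

  step-back : ∀ xs ls rs {ts} →
    Halts (sweep 0F stepLeft) (back (cells xs ++ nothing ∷ ls) rs ∷ ts) (length xs)
      (tape ls nothing (emit xs rs) ∷ ts)
  step-back []       ls rs = sweep-stop refl
  step-back (x ∷ xs) ls rs = sweep-step refl (cong (_∷ _) (act-left _)) (step-back xs ls _)

  rewind-halts : ∀ xs ls {ts} →
    ∃[ t ] contents t ≡ map inj₁ xs ×
      Halts rewind (tape (emit xs (nothing ∷ ls)) nothing [] ∷ ts) (1 + (length xs + 1)) (t ∷ ts)
  rewind-halts xs ls {ts}
    with h ← step-back (reverse xs) ls [ nothing ] {ts}
    rewrite length-reverse xs | sym (emit≡reverse xs (nothing ∷ ls)) | emit-reverse xs [ nothing ] =
    _ , contents-front (nothing ∷ ls) xs ,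
    (once-halts (cong (_∷ ts) (act-left _)) then h then once-halts (cong (_∷ ts) (act-right _ _)))

  countLeft : Cell → Maybe (List Instr)
  countLeft nothing  = nothing
  countLeft (just x) = just (write tick ∷ (1F , just x , left) ∷ [])

  countRight : Cell → Maybe (List Instr)
  countRight nothing  = nothing
  countRight (just x) = just (write tick ∷ (1F , just x , right) ∷ [])

  -- Tape 1, holding j cells, serves as a unary counter; tape 2 limits the number of edges.
  appendEdge : Prog
  appendEdge =
    always [ 1F , nothing , left ] ⨾ sweep 1F countLeft ⨾
    always (write comma ∷ (1F , nothing , right) ∷ []) ⨾ always [ write tick ] ⨾
    sweep 1F countRight ⨾
    always (write comma ∷ (1F , tok tick , right) ∷ (2F , nothing , left) ∷ [])

  count-left : ∀ xs ls rs O {ts} →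
    Halts (sweep 1F countLeft)
      (tape O nothing [] ∷ back (cells xs ++ nothing ∷ ls) rs ∷ ts) (length xs)
      (tape (emit (encℕ (length xs)) O) nothing [] ∷ tape ls nothing (emit xs rs) ∷ ts)
  count-left []       ls rs O = sweep-stop refl
  count-left (x ∷ xs) ls rs O = sweep-step refl
    (cong₂ (λ s t → s ∷ t ∷ _) (append O _) (act-left _)) (count-left xs ls _ _)

  count-right : ∀ xs ls O {ts} →
    Halts (sweep 1F countRight)
      (tape O nothing [] ∷ front ls (cells xs ++ [ nothing ]) ∷ ts) (length xs)
      (tape (emit (encℕ (length xs)) O) nothing [] ∷ tape (emit xs ls) nothing [] ∷ ts)
  count-right []       ls O = sweep-stop refl
  count-right (x ∷ xs) ls O = sweep-step refl
    (cong₂ (λ s t → s ∷ t ∷ _) (append O _) (act-right _ _)) (count-right xs _ _)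

  appendTime : ℕ → ℕ
  appendTime j = 1 + (j + (1 + (1 + (j + 1))))

  -- The counter is traversed twice, leftwards for the source and rightwards for the target, whose
  -- one extra tick is written in between. It then grows by a cell, ready for the next vertex, while
  -- tape 2 loses one.
  append-edge : ∀ xs O ls c rs {ts} →
    Halts appendEdge
      (tape O nothing [] ∷ tape (cells xs ++ [ nothing ]) nothing [] ∷ tape ls c rs ∷ ts)
      (appendTime (length xs))
      (tape (emit (edgeTokens (length xs)) O) nothing []
        ∷ tape (cells (tick ∷ xs) ++ [ nothing ]) nothing [] ∷ back ls (nothing ∷ rs) ∷ ts)
  append-edge xs O ls c rs {ts} with
    h ← count-right (reverse xs) [ nothing ]
          (tok tick ∷ tok comma ∷ emit (encℕ (length xs)) O) {tape ls c rs ∷ ts}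
    rewrite length-reverse xs | sym (emit≡reverse xs [ nothing ]) | emit-reverse xs [ nothing ] =
    once-halts (cong (λ t → _ ∷ t ∷ _) (act-left _)) then
    count-left xs [] [ nothing ] O then
    once-halts (cong₂ (λ s t → s ∷ t ∷ _) (append _ _) (act-right _ _)) then
    once-halts (cong (_∷ front [ nothing ] (emit xs [ nothing ]) ∷ tape ls c rs ∷ ts)
      (append _ _)) then
    h then
    once-halts (trans
      (cong₂ (λ { s (t , u) → s ∷ t ∷ u ∷ _ }) (append _ _)
        (cong₂ _,_ (act-right _ _) (act-left _)))
      (cong (λ l → tape l nothing [] ∷ _) (sym
        (trans (emit-++ (encℕ j) _ O) (emit-++ (encℕ (suc j)) [ comma ] _)))))
    where j = length xs

  appendPath : Prog
  appendPath = while 2F is-just appendEdge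

  pathTime : ℕ → ℕ → ℕ
  pathTime j zero    = 0
  pathTime j (suc b) = 2 + (appendTime j + pathTime (suc j) b)

  append-path : ∀ ys xs O rs {ts} →
    ∃[ t₁ ] ∃[ t₂ ] Halts appendPath
      (tape O nothing [] ∷ tape (cells xs ++ [ nothing ]) nothing [] ∷ back (cells ys) rs ∷ ts)
      (pathTime (length xs) (length ys))
      (tape (emit (pathTokens (length xs) (length ys)) O) nothing [] ∷ t₁ ∷ t₂ ∷ ts)
  append-path []       xs O rs = _ , _ , while-stop refl
  append-path (y ∷ ys) xs O rs {ts}
    with t₁ , t₂ , h ← append-path ys (tick ∷ xs) (emit (edgeTokens (length xs)) O)
                         (nothing ∷ rs) {ts}
    rewrite sym (emit-++ (edgeTokens (length xs)) (pathTokens (suc (length xs)) (length ys)) O) =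
    t₁ , t₂ , while-step refl (append-edge xs O (cells ys) _ rs) h

  blanks : ∀ {n} → Vec (Tape Γ) n
  blanks = Vec.replicate _ blankTape

  -- The input is not erased from tape 0. The output goes to its right behind a blank, at which
  -- `rewind` stops, so that `contents` finally sees the output only.
  load : Prog
  load = copyRight 0F [ 3F ] ⨾ always ((0F , nothing , right) ∷ (3F , nothing , left) ∷ [])

  load-halts : ∀ xs →
    Halts load (written (map inj₁ xs) ∷ blanks) (length xs + 1)
      (tape (nothing ∷ emit xs []) nothing [] ∷ blankTape ∷ blankTape
        ∷ back (cells (reverse xs)) [ nothing ] ∷ blankTape ∷ blankTape ∷ blanks)
  load-halts xs rewrite written≡front xs =
    copy-input xs [] [] then
    once-halts (cong₂ (λ s t → s ∷ _ ∷ _ ∷ t ∷ _) (append _ _)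
      (trans (act-left _) (cong (λ l → back l _) (trans (emit≡reverse xs []) (++-identityʳ _)))))

  shuffleProgram : Prog
  shuffleProgram = load ⨾ prepare ⨾ copyRight 5F (0F ∷ 2F ∷ []) ⨾
    always (write comma ∷ (1F , nothing , right) ∷ []) ⨾ copyRight 1F [ 0F ] ⨾ rewind

  reverse-cells : ∀ rs ps → cells (reverse (rs ++ hash ∷ ps)) ≡
                            cells (reverse ps) ++ tok hash ∷ cells (reverse rs)
  reverse-cells rs ps = begin
    cells (reverse (rs ++ hash ∷ ps))
      ≡⟨ cong cells (reverse-++ rs (hash ∷ ps)) ⟩
    cells (reverse (hash ∷ ps) ++ reverse rs)
      ≡⟨ cong (λ l → cells (l ++ reverse rs)) (unfold-reverse hash ps) ⟩
    cells ((reverse ps ++ [ hash ]) ++ reverse rs)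
      ≡⟨ cong cells (++-assoc (reverse ps) _ _) ⟩
    cells (reverse ps ++ hash ∷ reverse rs)
      ≡⟨ cells-++ (reverse ps) _ ⟩
    cells (reverse ps) ++ tok hash ∷ cells (reverse rs)  ∎
    where open ≡-Reasoning

  -- Nested like `shuffleProgram`, one summand per part, so that a chain of `then` has this bound
  -- without any arithmetic; likewise for `sortTime`.
  shuffleTime : ℕ → ℕ → ℕ → ℕ → ℕ → ℕ
  shuffleTime n r p b f = (n + 1) + ((p + (1 + (r * 4 + b))) +
    (f + (1 + (p + (1 + ((f + suc p) + 1))))))

  shuffle-halts : ∀ rs ps {ys b} → NoHash ps →
    Computes rs ++ hash ∷ encℕ (letters ps) to ys within b →
    ∃[ t ] ∃[ ts ] contents t ≡ map inj₁ (ys ++ comma ∷ ps) ×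
      Halts shuffleProgram (written (map inj₁ (rs ++ hash ∷ ps)) ∷ blanks)
        (shuffleTime (length (rs ++ hash ∷ ps)) (length rs) (length ps) b (length ys)) (t ∷ ts)
  shuffle-halts rs ps {ys} {b} nh run
    with h₁ ← load-halts (rs ++ hash ∷ ps)
    rewrite reverse-cells rs ps
    with t₃ , tape ls c cs , vs , e , h₂ ← prepare-halts rs ps [ nothing ]
           {tape (nothing ∷ emit (rs ++ hash ∷ ps) []) nothing []} {blankTape} {blankTape} nh run
    with t₅ , h₃ ← copy-filter ys (nothing ∷ emit (rs ++ hash ∷ ps) []) [] ls (c ∷ cs)
                     {tape [] nothing (cells ps)} {t₃} {blankTape} {vs} e
    with t , e′ , h₄ ← rewind-halts (ys ++ comma ∷ ps) (emit (rs ++ hash ∷ ps) [])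
                     {tape (emit ps [ nothing ]) nothing [] ∷ tape (emit ys []) nothing []
                       ∷ t₃ ∷ blankTape ∷ t₅ ∷ vs}
    rewrite emit-++ ys (comma ∷ ps) (nothing ∷ emit (rs ++ hash ∷ ps) [])
          | length-++ ys {comma ∷ ps} =
    t , _ , e′ , (h₁ then h₂ then h₃ then
      once-halts (cong₂ (λ s t → s ∷ t ∷ _) (append _ _) (act-right _ _)) then
      copy-labels ps _ _ then h₄)

  sortProgram : Prog
  sortProgram = load ⨾ stashEdges ⨾ always [ 3F , nothing , left ] ⨾ prepare ⨾
    always [ 1F , nothing , right ] ⨾ copyRight 1F [ 0F ] ⨾
    copyRight 5F (0F ∷ 2F ∷ []) ⨾
    -- The first move reaches the last letter of the filter word and the second erases it: a path
    -- has one edge fewer than vertices. On an empty word both moves stay among blanks.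
    always [ 2F , nothing , left ] ⨾ always [ 2F , nothing , left ] ⨾
    always (write hash ∷ (4F , nothing , right) ∷ []) ⨾ copyRight 4F [ 0F ] ⨾
    appendPath ⨾ rewind

  sortTime : ℕ → ℕ → ℕ → ℕ → ℕ → ℕ → ℕ
  sortTime n r p e b f = (n + 1) + (e + (1 + ((p + (1 + (r * 4 + b))) + (1 + (p + (f + (1 + (1 +
    (1 + (e + (pathTime p (pred f) +
    (1 + (((p + f) + suc (e + length (pathTokens {k} p (pred f)))) + 1)))))))))))))

  ∸1≡pred : ∀ n → n ∸ 1 ≡ pred n
  ∸1≡pred zero    = refl
  ∸1≡pred (suc n) = refl

  module _ (rs ps es ys : List (Token k)) where

    private
      path input output : List (Token k)
      path   = pathTokens (length ps) (pred (length ys))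
      input  = rs ++ hash ∷ ps ++ hash ∷ es
      output = (ps ++ ys) ++ hash ∷ es ++ path
      O : List Cell
      O = nothing ∷ emit input []

      reverse-input : cells (reverse input) ≡
        cells (reverse es) ++ tok hash ∷ cells (reverse ps) ++ tok hash ∷ cells (reverse rs)
      reverse-input = begin
        cells (reverse input)
          ≡⟨ cong (cells ∘ reverse) (++-assoc rs (hash ∷ ps) (hash ∷ es)) ⟨
        cells (reverse ((rs ++ hash ∷ ps) ++ hash ∷ es))
          ≡⟨ reverse-cells (rs ++ hash ∷ ps) es ⟩
        cells (reverse es) ++ tok hash ∷ cells (reverse (rs ++ hash ∷ ps))
          ≡⟨ cong (λ l → cells (reverse es) ++ tok hash ∷ l) (reverse-cells rs ps) ⟩
        cells (reverse es) ++ tok hash ∷ cells (reverse ps) ++ tok hash ∷ cells (reverse rs) ∎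
        where open ≡-Reasoning

      length-output : length output ≡ (length ps + length ys) + suc (length es + length path)
      length-output = trans (length-++ (ps ++ ys))
        (cong₂ _+_ (length-++ ps) (cong suc (length-++ es)))

      emit-output : emit output O ≡ emit path (emit es (tok hash ∷ emit ys (emit ps O)))
      emit-output = begin
        emit output O                                   ≡⟨ emit-++ (ps ++ ys) _ O ⟩
        emit (es ++ path) (tok hash ∷ emit (ps ++ ys) O)
          ≡⟨ cong (λ l → emit (es ++ path) (tok hash ∷ l)) (emit-++ ps ys O) ⟩
        emit (es ++ path) (tok hash ∷ emit ys (emit ps O)) ≡⟨ emit-++ es path _ ⟩
        emit path (emit es (tok hash ∷ emit ys (emit ps O))) ∎
        where open ≡-Reasoning

    sort-halts : ∀ {b} → NoHash ps → NoHash es →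
      Computes rs ++ hash ∷ encℕ (letters ps) to ys within b →
      ∃[ t ] ∃[ ts ] contents t ≡ map inj₁ output ×
        Halts sortProgram (written (map inj₁ input) ∷ blanks)
          (sortTime (length input) (length rs) (length ps) (length es) b (length ys)) (t ∷ ts)
    sort-halts {b} nh nh′ run
      with h₁ ← load-halts input
         | h₂ ← stash-edges (reverse es) (cells (reverse ps) ++ tok hash ∷ cells (reverse rs))
                  [ nothing ] [] {tape O nothing []} {blankTape} {blankTape} {blankTape ∷ blanks}
                  (All-ʳ++⁺ nh′ [])
      rewrite sym reverse-input | length-reverse es | emit-reverse es [] | ++-identityʳ (cells es)
      with t₃ , tape ls c cs , vs , e , h₄ ← prepare-halts rs ps
             (nothing ∷ emit (reverse es) [ nothing ])
             {tape O nothing []} {blankTape} {tape [] nothing (cells es)} nh run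
      with t₅ , h₇ ← copy-filter ys (emit ps O) [] ls (c ∷ cs)
             {tape (emit ps [ nothing ]) nothing []} {t₃} {tape [] nothing (cells es)} {vs} e
      -- The labels on tape 1 act as the counter, so the path starts at vertex number `length ps`;
      -- the shortened filter word on tape 2 limits its edges.
      with t₁ , t₂ , h₁₂ ← append-path (drop 1 (reverse ys)) (reverse ps)
             (emit es (tok hash ∷ emit ys (emit ps O))) (nothing ∷ nothing ∷ [])
             {t₃ ∷ tape (emit es [ nothing ]) nothing [] ∷ t₅ ∷ vs}
      with t , e′ , h₁₃ ← rewind-halts output (emit input [])
             {t₁ ∷ t₂ ∷ t₃ ∷ tape (emit es [ nothing ]) nothing [] ∷ t₅ ∷ vs}
      rewrite length-reverse ps | sym (emit≡reverse ps [ nothing ]) | length-drop 1 (reverse ys)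
            | length-reverse ys | ∸1≡pred (length ys) | length-output | emit-output =
      let A  = tape (emit ys (emit ps O)) nothing []
          B  = tape (emit ps [ nothing ]) nothing []
          E  = tape [] nothing (cells es)
          Z  = tape O nothing []
      in t , _ , e′ ,
      (h₁ then h₂ then
       once-halts (cong (λ t → Z ∷ blankTape ∷ blankTape ∷ t ∷ E ∷ blankTape ∷ blanks)
         (act-left _)) then
       h₄ then
       once-halts (cong (λ t → Z ∷ t ∷ blankTape ∷ t₃ ∷ E ∷ tape ls c cs ∷ vs) (act-right _ _)) then
       copy-labels ps O [ nothing ] then h₇ then
       once-halts (cong (λ t → A ∷ B ∷ t ∷ t₃ ∷ E ∷ t₅ ∷ vs) (trans (act-left _)
         (cong (λ l → back l _) (trans (emit≡reverse ys []) (++-identityʳ _))))) then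
       once-halts (cong (λ t → A ∷ B ∷ t ∷ t₃ ∷ E ∷ t₅ ∷ vs) (act-left-back (reverse ys))) then
       once-halts (cong₂ (λ s t → s ∷ B ∷ back _ (nothing ∷ nothing ∷ []) ∷ t₃ ∷ t ∷ t₅ ∷ vs)
         (append _ _) (act-right (cells es) _)) then
       copy-edges es _ _ then h₁₂ then h₁₃)

-- Interleavings of finite sequences

-- A mask telling from which of two sequences, of lengths n and m, each entry of
-- their interleaving comes.
data Riffle : ℕ → ℕ → ℕ → Set where
  nil   : Riffle 0 0 0
  left  : Riffle n m p → Riffle (suc n) m (suc p)
  right : Riffle n m p → Riffle n (suc m) (suc p)

source : Riffle n m p → Fin p → Fin n ⊎ Fin m
source (left s)  zero    = inj₁ zero
source (left s)  (suc i) = Sum.map suc id (source s i)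
source (right s) zero    = inj₂ zero
source (right s) (suc i) = Sum.map id suc (source s i)

position : Riffle n m p → Fin n ⊎ Fin m → Fin p
position (left s)  (inj₁ zero)    = zero
position (left s)  (inj₁ (suc i)) = suc (position s (inj₁ i))
position (left s)  (inj₂ j)       = suc (position s (inj₂ j))
position (right s) (inj₁ i)       = suc (position s (inj₁ i))
position (right s) (inj₂ zero)    = zero
position (right s) (inj₂ (suc j)) = suc (position s (inj₂ j))

source-position : ∀ (s : Riffle n m p) x → source s (position s x) ≡ x
source-position (left s)  (inj₁ zero)    = refl
source-position (left s)  (inj₁ (suc i)) = cong (Sum.map suc id) (source-position s (inj₁ i))
source-position (left s)  (inj₂ j)       = cong (Sum.map suc id) (source-position s (inj₂ j))
source-position (right s) (inj₁ i)       = cong (Sum.map id suc) (source-position s (inj₁ i))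
source-position (right s) (inj₂ zero)    = refl
source-position (right s) (inj₂ (suc j)) = cong (Sum.map id suc) (source-position s (inj₂ j))

position-source : ∀ (s : Riffle n m p) i → position s (source s i) ≡ i
position-source (left s)  zero    = refl
position-source (left s)  (suc i) with source s i | position-source s i
... | inj₁ _ | e = cong suc e
... | inj₂ _ | e = cong suc e
position-source (right s) zero    = refl
position-source (right s) (suc i) with source s i | position-source s i
... | inj₁ _ | e = cong suc e
... | inj₂ _ | e = cong suc e

position-mono-inj₁ : ∀ (s : Riffle n m p) {i j} → i < j →
                     position s (inj₁ i) < position s (inj₁ j)
position-mono-inj₁ (left s)  {zero}  {suc j} _       = s≤s z≤n
position-mono-inj₁ (left s)  {suc i} {suc j} (s≤s l) = s≤s (position-mono-inj₁ s l)
position-mono-inj₁ (right s) l                       = s≤s (position-mono-inj₁ s l)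

position-mono-inj₂ : ∀ (s : Riffle n m p) {i j} → i < j →
                     position s (inj₂ i) < position s (inj₂ j)
position-mono-inj₂ (left s)  l                       = s≤s (position-mono-inj₂ s l)
position-mono-inj₂ (right s) {zero}  {suc j} _       = s≤s z≤n
position-mono-inj₂ (right s) {suc i} {suc j} (s≤s l) = s≤s (position-mono-inj₂ s l)

mono⇒reflects-< : (f : Fin n → Fin p) → (∀ {i j} → i < j → f i < f j) →
                  ∀ {i j} → f i < f j → i < j
mono⇒reflects-< f mono {i} {j} l with <-cmp i j
... | tri< i<j _ _  = i<j
... | tri≈ _ refl _ = contradiction l (<-irrefl refl)
... | tri> _ _ j<i  = contradiction l (<-asym (mono j<i))

riffle-size : Riffle n m p → p ≡ n + m
riffle-size nil               = refl
riffle-size (left s)          = cong suc (riffle-size s)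
riffle-size {n} (right {m = m} s) = trans (cong suc (riffle-size s)) (sym (+-suc n m))

riffle⇒interleaving : (s : Riffle n m p) (g : Fin n → A) (h : Fin m → A) →
  Interleaving (tabulate g) (tabulate h) (tabulate ([ g , h ]′ ∘ source s))
riffle⇒interleaving nil       g h = []
riffle⇒interleaving (left s)  g h
  rewrite tabulate-cong {f = [ g , h ]′ ∘ Sum.map suc id ∘ source s} ([,]-map ∘ source s) =
  consˡ (riffle⇒interleaving s (g ∘ suc) h)
riffle⇒interleaving (right s) g h
  rewrite tabulate-cong {f = [ g , h ]′ ∘ Sum.map id suc ∘ source s} ([,]-map ∘ source s) =
  consʳ (riffle⇒interleaving s g (h ∘ suc))

-- Both sizes are split first, since only then does `tabulate` reduce and the interleaving become
-- open to case analysis.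
interleaving⇒riffle : ∀ n m (g : Fin n → A) (h : Fin m → A) {zs} →
  Interleaving (tabulate g) (tabulate h) zs →
  ∃[ p ] Σ[ s ∈ Riffle n m p ] zs ≡ tabulate ([ g , h ]′ ∘ source s)
interleaving⇒riffle zero    zero    g h []        = _ , nil , refl
interleaving⇒riffle (suc n) zero    g h (consˡ i)
  with p , s , refl ← interleaving⇒riffle n zero (g ∘ suc) h i =
  _ , left s , cong (_ ∷_) (tabulate-cong (sym ∘ [,]-map ∘ source s))
interleaving⇒riffle (suc n) (suc m) g h (consˡ i)
  with p , s , refl ← interleaving⇒riffle n (suc m) (g ∘ suc) h i =
  _ , left s , cong (_ ∷_) (tabulate-cong (sym ∘ [,]-map ∘ source s))
interleaving⇒riffle zero    (suc m) g h (consʳ i)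
  with p , s , refl ← interleaving⇒riffle zero m g (h ∘ suc) i =
  _ , right s , cong (_ ∷_) (tabulate-cong (sym ∘ [,]-map ∘ source s))
interleaving⇒riffle (suc n) (suc m) g h (consʳ i)
  with p , s , refl ← interleaving⇒riffle (suc n) m g (h ∘ suc) i =
  _ , right s , cong (_ ∷_) (tabulate-cong (sym ∘ [,]-map ∘ source s))

-- The tags of `c` form the mask; the entries of either side, in order of occurrence, form `g` and
-- `h`.
riffle-of : ∀ p (c : Fin p → A ⊎ B) →
  ∃[ n ] ∃[ m ] Σ[ s ∈ Riffle n m p ] Σ[ g ∈ (Fin n → A) ] Σ[ h ∈ (Fin m → B) ]
    (∀ i → c i ≡ Sum.map g h (source s i))
riffle-of zero    c = 0 , 0 , nil , (λ ()) , (λ ()) , λ ()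
riffle-of (suc p) c with c zero in eq | riffle-of p (c ∘ suc)
... | inj₁ a | n , m , s , g , h , e = _ , _ , left s , a Vector.∷ g , h , λ where
  zero    → eq
  (suc i) → trans (e i) (sym (map-map (source s i)))
... | inj₂ b | n , m , s , g , h , e = _ , _ , right s , g , b Vector.∷ h , λ where
  zero    → eq
  (suc i) → trans (e i) (sym (map-map (source s i)))

-- Factoring a permutation of a disjoint union

module _ {n m p : ℕ} (c : Fin p ↔ (Fin n ⊎ Fin m)) where

  record Split : Set where
    field
      riffle  : Riffle n m p
      left-π  : Permutation′ n
      right-π : Permutation′ m
      to≡     : ∀ i → Inverse.to c i ≡ Sum.map (left-π ⟨$⟩ʳ_) (right-π ⟨$⟩ʳ_) (source riffle i)

    from≡ : ∀ x → Inverse.from c x ≡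
                  position riffle (Sum.map (left-π ⟨$⟩ˡ_) (right-π ⟨$⟩ˡ_) x)
    from≡ x = Inverse.inverseʳ c (trans (lemma x) (sym (trans (to≡ _)
      (cong (Sum.map (left-π ⟨$⟩ʳ_) (right-π ⟨$⟩ʳ_)) (source-position riffle _)))))
      where
      lemma : ∀ x → x ≡ Sum.map (left-π ⟨$⟩ʳ_) (right-π ⟨$⟩ʳ_)
                          (Sum.map (left-π ⟨$⟩ˡ_) (right-π ⟨$⟩ˡ_) x)
      lemma (inj₁ x) = cong inj₁ (sym (inverseʳ left-π))
      lemma (inj₂ y) = cong inj₂ (sym (inverseʳ right-π))

  -- The part sizes `n′` and `m′` found by `riffle-of` are not known in advance. Surjectivity of `g`
  -- and `h` comes from `e″`, injectivity from `e′` since `position s` is injective; these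
  -- bijections then force `n′ = n` and `m′ = m`.
  split : Split
  split with n′ , m′ , s , g , h , e ← riffle-of p (Inverse.to c) = result
    where
    e′ : ∀ x → Inverse.from c (Sum.map g h x) ≡ position s x
    e′ x = Inverse.inverseʳ c (sym (trans (e _) (cong (Sum.map g h) (source-position s x))))

    e″ : ∀ x → Sum.map g h (source s (Inverse.from c x)) ≡ x
    e″ x = trans (sym (e _)) (Inverse.inverseˡ c refl)

    preimage₁ : ∀ x → ∃[ i ] g i ≡ x
    preimage₁ x with source s (Inverse.from c (inj₁ x)) | e″ (inj₁ x)
    ... | inj₁ i | q = i , inj₁-injective q

    preimage₂ : ∀ y → ∃[ j ] h j ≡ y
    preimage₂ y with source s (Inverse.from c (inj₂ y)) | e″ (inj₂ y)
    ... | inj₂ j | q = j , inj₂-injective q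

    position-injective : ∀ {x y} → position s x ≡ position s y → x ≡ y
    position-injective {x} {y} q =
      trans (sym (source-position s x)) (trans (cong (source s) q) (source-position s y))

    gπ : Permutation n′ n
    gπ = permutation g (proj₁ ∘ preimage₁) (proj₂ ∘ preimage₁) λ i → inj₁-injective
      (position-injective (trans (sym (e′ _)) (trans
        (cong (Inverse.from c ∘ inj₁) (proj₂ (preimage₁ (g i)))) (e′ _))))

    hπ : Permutation m′ m
    hπ = permutation h (proj₁ ∘ preimage₂) (proj₂ ∘ preimage₂) λ j → inj₂-injective
      (position-injective (trans (sym (e′ _)) (trans
        (cong (Inverse.from c ∘ inj₂) (proj₂ (preimage₂ (h j)))) (e′ _))))

    result : Split
    result with refl ← ↔⇒≡ gπ | refl ← ↔⇒≡ hπ =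
      record { riffle = s ; left-π = gπ ; right-π = hπ ; to≡ = e }

steps⇒mono : (h : Fin (suc m) → Fin p) → (∀ i → h (inject₁ i) < h (suc i)) →
             ∀ {i j} → i < j → h i < h j
steps⇒mono {suc m} h step {zero}  {suc zero}    _       = step zero
steps⇒mono {suc m} h step {zero}  {suc (suc j)} _       =
  <-trans (step zero) (steps⇒mono (h ∘ suc) (step ∘ suc) {zero} {suc j} (s≤s z≤n))
steps⇒mono {suc m} h step {suc i} {suc j}       (s≤s l) = steps⇒mono (h ∘ suc) (step ∘ suc) l

mono⇒inflationary : ∀ m (h : Fin m → ℕ) → (∀ {i j} → i < j → h i <ℕ h j) → ∀ i → toℕ i ≤ h i
mono⇒inflationary m h mono i = ≤-trans (m≤m+n _ _) (go m h mono i)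
  where
  first : ∀ {m} → (Fin m → ℕ) → ℕ
  first {zero}  h = 0
  first {suc _} h = h zero

  -- The claim is strengthened by the first value of `h`: passing to `h ∘ suc` raises that value by
  -- at least one, which pays for the larger index. The value 0 for an empty domain is never
  -- reached.
  go : ∀ m (h : Fin m → ℕ) → (∀ {i j} → i < j → h i <ℕ h j) → ∀ i → toℕ i + first h ≤ h i
  go (suc m)       h mono zero    = ≤-refl
  go (suc (suc m)) h mono (suc i) = begin
    suc (toℕ i + h zero)   ≡⟨ +-suc (toℕ i) (h zero) ⟨
    toℕ i + suc (h zero)   ≤⟨ +-monoʳ-≤ (toℕ i) (mono (s≤s z≤n)) ⟩
    toℕ i + h (suc zero)   ≤⟨ go (suc m) (h ∘ suc) (mono ∘ s≤s) i ⟩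
    h (suc i)              ∎
    where open ≤-Reasoning

-- An increasing map is inflationary, and so is its inverse.
mono-permutation : (π : Permutation′ m) → (∀ {i j} → i < j → π ⟨$⟩ˡ i < π ⟨$⟩ˡ j) →
                   ∀ i → π ⟨$⟩ʳ i ≡ i
mono-permutation {m} π mono i = toℕ-injective (≤-antisym
  (subst (λ j → toℕ (π ⟨$⟩ʳ i) ≤ toℕ j) (inverseˡ π)
    (mono⇒inflationary m (toℕ ∘ (π ⟨$⟩ˡ_)) mono (π ⟨$⟩ʳ i)))
  (mono⇒inflationary m (toℕ ∘ (π ⟨$⟩ʳ_))
    (λ i<j → mono⇒reflects-< (π ⟨$⟩ˡ_) mono
      (subst₂ _<_ (sym (inverseˡ π)) (sym (inverseˡ π)) i<j)) i))

-- Adding a path to a DAG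

tabulate-splitAt : ∀ n (g : Fin n → A) (xs : List A) →
                   tabulate ([ g , lookup xs ]′ ∘ splitAt n) ≡ tabulate g ++ xs
tabulate-splitAt zero    g xs = tabulate-lookup xs
tabulate-splitAt (suc n) g xs = cong (g zero ∷_)
  (trans (tabulate-cong ([,]-map ∘ splitAt n)) (tabulate-splitAt n (g ∘ suc) xs))

-- A copy of the function local to `encDAG`, so that the statements below can name it.
encEdge : Fin n × Fin n → List (Token k)
encEdge (u , v) = encℕ (toℕ u) ++ comma ∷ encℕ (toℕ v) ++ [ comma ]

encDAG≡ : (G : DAG k) → let open DAG G in
          encDAG G ≡ encWord (tabulate label) ++ hash ∷ concatMap encEdge edges
encDAG≡ G = cong (λ es → encWord (tabulate label) ++ hash ∷ es)
                 (concatMap-cong (λ _ → refl) edges)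
  where open DAG G

concatMap-encEdge-tabulate : ∀ j b (g : Fin b → Fin n × Fin n) →
  (∀ i → toℕ (proj₁ (g i)) ≡ j + toℕ i) → (∀ i → toℕ (proj₂ (g i)) ≡ suc (j + toℕ i)) →
  concatMap encEdge (tabulate g) ≡ pathTokens {k} j b
concatMap-encEdge-tabulate j zero    g e e′ = refl
concatMap-encEdge-tabulate j (suc b) g e e′
  rewrite e zero | e′ zero | +-identityʳ j =
  cong (edgeTokens j ++_) (concatMap-encEdge-tabulate (suc j) b (g ∘ suc)
    (λ i → trans (e (suc i)) (+-suc j (toℕ i)))
    (λ i → trans (e′ (suc i)) (cong suc (+-suc j (toℕ i)))))

consecutive : ∀ m → List (Fin m × Fin m)
consecutive zero    = []
consecutive (suc m) = tabulate λ i → inject₁ i , suc i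

consecutive⇒< : ∀ m {i j} → (i , j) ∈ consecutive m → i < j
consecutive⇒< (suc m) ij∈ with i , refl ← ∈-tabulate⁻ ij∈ =
  s≤s (≤-reflexive (toℕ-inject₁ i))

consecutive-mono : ∀ m (h : Fin m → Fin p) → (∀ {i j} → (i , j) ∈ consecutive m → h i < h j) →
                   ∀ {i j} → i < j → h i < h j
consecutive-mono (suc m) h step = steps⇒mono h (λ i → step (∈-tabulate⁺ i))

module _ (G : DAG k) (f : Word k) where

  open DAG G

  private
    m′ = length f

    oldEdge : Fin size × Fin size → Fin (size + m′) × Fin (size + m′)
    oldEdge (u , v) = u ↑ˡ m′ , v ↑ˡ m′

    newEdge : Fin m′ × Fin m′ → Fin (size + m′) × Fin (size + m′)
    newEdge (i , j) = size ↑ʳ i , size ↑ʳ j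

    edges′ : List (Fin (size + m′) × Fin (size + m′))
    edges′ = map oldEdge edges ++ map newEdge (consecutive m′)

    -- No constructor links the two sides, so a cycle would stay within one of them. For the path
    -- only the order is kept: it is transitive and irreflexive, which settles acyclicity there.
    data Edge⊎ : Fin size ⊎ Fin m′ → Fin size ⊎ Fin m′ → Set where
      old : ∀ {u v} → Edge u v → Edge⊎ (inj₁ u) (inj₁ v)
      new : ∀ {i j} → i < j → Edge⊎ (inj₂ i) (inj₂ j)

    splitEdge : ∀ {u v} → (u , v) ∈ edges′ → Edge⊎ (splitAt size u) (splitAt size v)
    splitEdge e with ∈-++⁻ (map oldEdge edges) e
    ... | inj₁ e′ with (u , v) , uv∈ , refl ← ∈-map⁻ oldEdge e′
      rewrite splitAt-↑ˡ size u m′ | splitAt-↑ˡ size v m′ = old uv∈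
    ... | inj₂ e′ with (i , j) , ij∈ , refl ← ∈-map⁻ newEdge e′
      rewrite splitAt-↑ʳ size m′ i | splitAt-↑ʳ size m′ j = new (consecutive⇒< m′ ij∈)

    splitPath : ∀ {u v} → TransClosure (λ u v → (u , v) ∈ edges′) u v →
                TransClosure Edge⊎ (splitAt size u) (splitAt size v)
    splitPath TransClosure.[ e ] = TransClosure.[ splitEdge e ]
    splitPath (e ∷ p)          = splitEdge e ∷ splitPath p

    oldPath : ∀ {u v} → TransClosure Edge⊎ (inj₁ u) (inj₁ v) → TransClosure Edge u v
    oldPath TransClosure.[ old e ] = TransClosure.[ e ]
    oldPath (old e ∷ p)            = e ∷ oldPath p

    newPath : ∀ {i j} → TransClosure Edge⊎ (inj₂ i) (inj₂ j) → i < j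
    newPath TransClosure.[ new l ] = l
    newPath (new l ∷ p)            = <-trans l (newPath p)

    acyclic⊎ : ∀ x → ¬ TransClosure Edge⊎ x x
    acyclic⊎ (inj₁ u) p = acyclic u (oldPath p)
    acyclic⊎ (inj₂ i) p = <-irrefl refl (newPath p)

  -- The path is numbered after the old vertices, which keep their numbers. The old edge tokens thus
  -- remain as they are, and the machine only has to append new ones.
  addPath : DAG k
  addPath = record
    { size    = size + m′
    ; label   = [ label , lookup f ]′ ∘ splitAt size
    ; edges   = edges′
    ; acyclic = λ v p → acyclic⊎ _ (splitPath p)
    }

  encDAG-addPath : encDAG addPath ≡
    (encWord (tabulate label) ++ encWord f) ++
    hash ∷ concatMap encEdge edges ++ pathTokens size (pred m′)
  encDAG-addPath = trans (encDAG≡ addPath) (cong₂ (λ xs ys → xs ++ hash ∷ ys)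
    (trans (cong encWord (tabulate-splitAt size label f)) (map-++ letter (tabulate label) f))
    (trans (concatMap-++ encEdge (map oldEdge edges) (map newEdge (consecutive m′)))
      (cong₂ _++_
        (trans (concatMap-map encEdge oldEdge edges)
          (concatMap-cong (λ (u , v) → cong₂ (λ i j → encℕ i ++ comma ∷ encℕ j ++ [ comma ])
            (toℕ-↑ˡ u m′) (toℕ-↑ˡ v m′)) edges))
        (path f))))
    where
    path : ∀ (f : Word k) → concatMap encEdge (map (λ (i , j) → size ↑ʳ i , size ↑ʳ j)
             (consecutive (length f))) ≡ pathTokens size (pred (length f))
    path []       = refl
    path (x ∷ xs) = trans
      (cong (concatMap encEdge) (map-tabulate {n = length xs} (λ i → inject₁ i , suc i) _))
      (concatMap-encEdge-tabulate size (length xs) _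
        (λ i → trans (toℕ-↑ʳ size (inject₁ i)) (cong (size +_) (toℕ-inject₁ i)))
        (λ i → trans (toℕ-↑ʳ size (suc i)) (+-suc size (toℕ i))))

  addPath-sort⁺ : ∀ {w} (σ : Permutation′ size) → IsTopologicalSort G σ →
    Interleaving (sortedWord G σ) f w →
    ∃[ σ′ ] IsTopologicalSort addPath σ′ × sortedWord addPath σ′ ≡ w
  addPath-sort⁺ {w} σ top i
    with p , s , refl ← interleaving⇒riffle size m′ (label ∘ (σ ⟨$⟩ʳ_)) (lookup f)
           (subst (λ f → Interleaving (sortedWord G σ) f w) (sym (tabulate-lookup f)) i)
    -- Identifies `p` with `size + m′`, so that the mask yields a permutation of the new vertex set.
    with refl ← riffle-size s =
    σ′ , (λ u v e → top′ (splitEdge e)) , tabulate-cong λ i →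
      trans (cong [ label , lookup f ]′ (splitAt-join size m′ (to (source s i))))
            ([,]-map (source s i))
    where
    to : Fin size ⊎ Fin m′ → Fin size ⊎ Fin m′
    to = Sum.map (σ ⟨$⟩ʳ_) id

    from : Fin size ⊎ Fin m′ → Fin size ⊎ Fin m′
    from = Sum.map (σ ⟨$⟩ˡ_) id

    to-from : ∀ x → to (from x) ≡ x
    to-from (inj₁ _) = cong inj₁ (inverseʳ σ)
    to-from (inj₂ _) = refl

    from-to : ∀ x → from (to x) ≡ x
    from-to (inj₁ _) = cong inj₁ (inverseˡ σ)
    from-to (inj₂ _) = refl

    σ′ : Permutation′ (size + m′)
    σ′ = permutation (join size m′ ∘ to ∘ source s) (position s ∘ from ∘ splitAt size)
      (λ v → trans (cong (join size m′ ∘ to) (source-position s _))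
        (trans (cong (join size m′) (to-from (splitAt size v))) (join-splitAt size m′ v)))
      (λ i → trans (cong (position s ∘ from) (splitAt-join size m′ (to (source s i))))
        (trans (cong (position s) (from-to (source s i))) (position-source s i)))

    top′ : ∀ {x y} → Edge⊎ x y → position s (from x) < position s (from y)
    top′ (old e) = position-mono-inj₁ s (top _ _ e)
    top′ (new l) = position-mono-inj₂ s l

  -- After `split`, old edges make `left-π` a topological sort and path edges make the inverse of
  -- `right-π` increasing, because `position` reflects the order on either side. By
  -- `mono-permutation` the second word is then `f` itself.
  addPath-sort⁻ : (σ′ : Permutation′ (size + m′)) → IsTopologicalSort addPath σ′ →
    ∃[ σ ] IsTopologicalSort G σ × Interleaving (sortedWord G σ) f (sortedWord addPath σ′)
  addPath-sort⁻ σ′ top = left-π , top′ ,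
    subst₂ (Interleaving (sortedWord G left-π))
      (trans (tabulate-cong (cong (lookup f) ∘ mono-permutation right-π right-mono))
             (tabulate-lookup f))
      (tabulate-cong λ i →
        sym (trans (cong [ label , lookup f ]′ (to≡ i)) ([,]-map (source riffle i))))
      (riffle⇒interleaving riffle (label ∘ (left-π ⟨$⟩ʳ_)) (lookup f ∘ (right-π ⟨$⟩ʳ_)))
    where
    position↔vertex : Fin (size + m′) ↔ (Fin size ⊎ Fin m′)
    position↔vertex = +↔⊎ ↔-∘ σ′

    open Split (split position↔vertex)

    top′ : IsTopologicalSort G left-π
    top′ u v e = mono⇒reflects-< (position riffle ∘ inj₁) (position-mono-inj₁ riffle)
      (subst₂ _<_ (from≡ (inj₁ u)) (from≡ (inj₁ v))
        (top _ _ (∈-++⁺ˡ (∈-map⁺ oldEdge e))))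

    right-mono : ∀ {i j} → i < j → right-π ⟨$⟩ˡ i < right-π ⟨$⟩ˡ j
    right-mono = consecutive-mono m′ (right-π ⟨$⟩ˡ_) λ {i} {j} ij∈ →
      mono⇒reflects-< (position riffle ∘ inj₂) (position-mono-inj₂ riffle)
        (subst₂ _<_ (from≡ (inj₂ i)) (from≡ (inj₂ j))
          (top _ _ (∈-++⁺ʳ (map oldEdge edges) (∈-map⁺ newEdge ij∈))))

-- Polynomial bounds

module _ {X : Set ℓ} (size : X → ℕ) where

  -- With a base of at least 1, powers grow with the exponent, so sums and products are bounded by
  -- just adding exponents.
  PolyBounded : (X → ℕ) → Set ℓ
  PolyBounded g = ∃[ c ] ∃[ d ] ∀ x → g x ≤ c * suc (size x) ^ d

  module _ {g h : X → ℕ} where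

    poly-≤ : (∀ x → g x ≤ h x) → PolyBounded h → PolyBounded g
    poly-≤ g≤h (c , d , b) = c , d , λ x → ≤-trans (g≤h x) (b x)

    poly-+ : PolyBounded g → PolyBounded h → PolyBounded (λ x → g x + h x)
    poly-+ (c , d , b) (c′ , d′ , b′) = c + c′ , d + d′ , λ x → let s = suc (size x) in begin
      g x + h x                                ≤⟨ +-mono-≤ (b x) (b′ x) ⟩
      c * s ^ d + c′ * s ^ d′
        ≤⟨ +-mono-≤ (*-monoʳ-≤ c (^-monoʳ-≤ s (m≤m+n d d′)))
                    (*-monoʳ-≤ c′ (^-monoʳ-≤ s (m≤n+m d′ d))) ⟩
      c * s ^ (d + d′) + c′ * s ^ (d + d′)     ≡⟨ *-distribʳ-+ (s ^ (d + d′)) c c′ ⟨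
      (c + c′) * s ^ (d + d′)                  ∎
      where open ≤-Reasoning

    poly-* : PolyBounded g → PolyBounded h → PolyBounded (λ x → g x * h x)
    poly-* (c , d , b) (c′ , d′ , b′) = c * c′ , d + d′ , λ x → let s = suc (size x) in begin
      g x * h x                     ≤⟨ *-mono-≤ (b x) (b′ x) ⟩
      (c * s ^ d) * (c′ * s ^ d′)   ≡⟨ [m*n]*[o*p]≡[m*o]*[n*p] c (s ^ d) c′ (s ^ d′) ⟩
      (c * c′) * (s ^ d * s ^ d′)   ≡⟨ cong (c * c′ *_) (^-distribˡ-+-* s d d′) ⟨
      (c * c′) * s ^ (d + d′)       ∎
      where open ≤-Reasoning

  poly-const : ∀ c → PolyBounded (λ _ → c)
  poly-const c = c , 0 , λ _ → ≤-reflexive (sym (*-identityʳ c))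

  poly-size : PolyBounded size
  poly-size = 1 , 1 , λ x → ≤-trans (n≤1+n _)
    (≤-reflexive (sym (trans (*-identityˡ _) (*-identityʳ _))))

  poly-^ : ∀ d → PolyBounded (λ x → size x ^ d)
  poly-^ d = 1 , d , λ x → ≤-trans (^-monoˡ-≤ d (n≤1+n _)) (≤-reflexive (sym (*-identityˡ _)))

-- From `1 + n ≤ 2 * n`. This is the passage from the base `suc n` of `PolyBounded` to the base `n`
-- of `PolyTime`, and the origin of the factor `2 ^ d` there.
suc^≤ : ∀ {n} d → 1 ≤ n → suc n ^ d ≤ 2 ^ d * n ^ d
suc^≤     zero    1≤n = ≤-refl
suc^≤ {n} (suc d) 1≤n = begin
  suc n * suc n ^ d
    ≤⟨ *-mono-≤ (+-mono-≤ 1≤n (≤-reflexive (sym (+-identityʳ n)))) (suc^≤ d 1≤n) ⟩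
  (2 * n) * (2 ^ d * n ^ d)      ≡⟨ [m*n]*[o*p]≡[m*o]*[n*p] 2 n (2 ^ d) (n ^ d) ⟩
  (2 * 2 ^ d) * (n * n ^ d)      ∎
  where open ≤-Reasoning

program-polyTime :
  ∀ {X : Set ℓ} {Y : Set ℓ′} {S : Set} {workSymbols workTapes : ℕ}
  (encX : X → List S) (encY : Y → List S) (f : X → Y) (time : X → ℕ)
  (P : Program {S ⊎ Fin workSymbols} {suc workTapes}) →
  (∀ x → 1 ≤ length (encX x)) → PolyBounded (length ∘ encX) time →
  (∀ x → ∃[ t ] ∃[ ts ] contents t ≡ map inj₁ (encY (f x)) ×
           Halts P (written (map inj₁ (encX x)) ∷ Vec.replicate workTapes blankTape)
                   (time x) (t ∷ ts)) →
  PolyTime encX encY f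
program-polyTime encX encY f time P nonempty (c , d , bound) run =
  toTM (compile P) , c * 2 ^ d , d , λ x →
    let t , ts , e , halts r    = run x
        n , q , n≤time , h      = toTM-halts (compile P) r
    in  n , (q , t ∷ ts) , ≤-trans n≤time (time≤ x) , h , e
  where
  time≤ : ∀ x → time x ≤ c * 2 ^ d * length (encX x) ^ d + c * 2 ^ d
  time≤ x = let n = length (encX x) in begin
    time x                                ≤⟨ bound x ⟩
    c * suc n ^ d                         ≤⟨ *-monoʳ-≤ c (suc^≤ d (nonempty x)) ⟩
    c * (2 ^ d * n ^ d)                   ≡⟨ *-assoc c (2 ^ d) (n ^ d) ⟨
    c * 2 ^ d * n ^ d                     ≤⟨ m≤m+n _ _ ⟩
    c * 2 ^ d * n ^ d + c * 2 ^ d         ∎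
    where open ≤-Reasoning

-- Letters and separators in the encodings

letters-encWord : ∀ (w : Word k) → letters (encWord w) ≡ length w
letters-encWord []      = refl
letters-encWord (_ ∷ w) = cong suc (letters-encWord w)

letters-++ : ∀ (xs ys : List (Token k)) → letters (xs ++ ys) ≡ letters xs + letters ys
letters-++ []       ys = refl
letters-++ (x ∷ xs) ys with isLetter x
... | true  = cong suc (letters-++ xs ys)
... | false = letters-++ xs ys

letters-encTuple : ∀ (U : List (Word k)) → letters (encTuple U) ≡ length (concat U)
letters-encTuple []      = refl
letters-encTuple (w ∷ U) = begin
  letters ((encWord w ++ [ comma ]) ++ encTuple U)
    ≡⟨ cong letters (++-assoc (encWord w) _ _) ⟩
  letters (encWord w ++ comma ∷ encTuple U)
    ≡⟨ letters-++ (encWord w) _ ⟩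
  letters (encWord w) + letters (encTuple U)
    ≡⟨ cong₂ _+_ (letters-encWord w) (letters-encTuple U) ⟩
  length w + length (concat U)
    ≡⟨ length-++ w ⟨
  length (w ++ concat U) ∎
  where open ≡-Reasoning

noHash-encWord : ∀ (w : Word k) → NoHash (encWord w)
noHash-encWord w = All.map⁺ (All.universal (λ _ → refl) w)

noHash-encℕ : ∀ n → NoHash {k} (encℕ n)
noHash-encℕ n = All.replicate⁺ n refl

noHash-encTuple : ∀ (U : List (Word k)) → NoHash (encTuple U)
noHash-encTuple U =
  All.concat⁺ (All.map⁺ (All.universal (λ w → All.++⁺ (noHash-encWord w) (refl ∷ [])) U))

noHash-encEdges : ∀ {n} (es : List (Fin n × Fin n)) → NoHash {k} (concatMap encEdge es)
noHash-encEdges es = All.concat⁺ (All.map⁺ (All.universal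
  (λ (u , v) → All.++⁺ (noHash-encℕ (toℕ u))
                 (refl ∷ All.++⁺ (noHash-encℕ (toℕ v)) (refl ∷ []))) es))

shuffle-length : ∀ {U : List (Word k)} {w} → Shuffle U w → length w ≡ length (concat U)
shuffle-length []      = refl
shuffle-length (_∷_ {u} i s) = trans (interleave-length i)
  (trans (cong (length u +_) (shuffle-length s)) (sym (length-++ u)))

edgeTime : ∀ j → 2 + (1 + (j + (1 + (1 + (j + 1))))) ≡ 6 + (j + j)
edgeTime j rewrite +-comm j 1 | +-suc j (suc (suc j)) | +-suc j (suc j) | +-suc j j = refl

-- The running times are polynomial

module _ (M : TM (Token k)) where

  open Programs M

  -- An edge with source `i` costs `6 + 2 * i` steps, and all sources are below `j + b`. This sum
  -- does not change from one edge to the next, so the induction closes.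
  pathTime-≤ : ∀ j b → pathTime j b ≤ b * (6 + ((j + b) + (j + b)))
  pathTime-≤ j zero    = z≤n
  pathTime-≤ j (suc b) rewrite +-suc j b = +-mono-≤
    (≤-trans (≤-reflexive (edgeTime j)) (+-monoʳ-≤ 6 (+-mono-≤ j≤ j≤)))
    (pathTime-≤ (suc j) b)
    where
    j≤ : j ≤ suc (j + b)
    j≤ = ≤-trans (m≤m+n j b) (n≤1+n _)

  -- Each token is written in a step of its own. The three further steps per edge are the first move
  -- of `appendEdge` and the two of the loop.
  length-pathTokens-≤ : ∀ j b → length (pathTokens {k} j b) ≤ pathTime j b
  length-pathTokens-≤ j zero    = z≤n
  length-pathTokens-≤ j (suc b) = begin
    length (edgeTokens {k} j ++ pathTokens (suc j) b)   ≡⟨ length-++ (edgeTokens j) ⟩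
    length (edgeTokens {k} j) + length (pathTokens {k} (suc j) b)
      ≡⟨ cong (_+ length (pathTokens {k} (suc j) b)) (length-edgeTokens j) ⟩
    (j + (1 + (1 + (j + 1)))) + length (pathTokens {k} (suc j) b)
      ≤⟨ +-mono-≤ (m≤n+m _ 3) (length-pathTokens-≤ (suc j) b) ⟩
    3 + (j + (1 + (1 + (j + 1)))) + pathTime (suc j) b    ∎
    where
    open ≤-Reasoning
    length-edgeTokens : ∀ j → length (edgeTokens {k} j) ≡ j + (1 + (1 + (j + 1)))
    length-edgeTokens j = trans (length-++ (encℕ j)) (cong₂ _+_ (length-replicate j)
      (cong (2 +_) (trans (length-++ (encℕ j)) (cong (_+ 1) (length-replicate j)))))

  module _ {X : Set ℓ} (size : X → ℕ) {n r p b f : X → ℕ}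
    (n-poly : PolyBounded size n) (r-poly : PolyBounded size r) (p-poly : PolyBounded size p)
    (b-poly : PolyBounded size b) (f-poly : PolyBounded size f) where

    infixr 6 _⊕_
    _⊕_ : ∀ {g h : X → ℕ} → PolyBounded size g → PolyBounded size h →
          PolyBounded size (λ x → g x + h x)
    _⊕_ = poly-+ size

    ♯ : ∀ c → PolyBounded size (λ _ → c)
    ♯ = poly-const size

    shuffleTime-poly : PolyBounded size (λ x → shuffleTime (n x) (r x) (p x) (b x) (f x))
    shuffleTime-poly = (n-poly ⊕ ♯ 1) ⊕ (p-poly ⊕ ♯ 1 ⊕ poly-* size r-poly (♯ 4) ⊕ b-poly) ⊕
      f-poly ⊕ ♯ 1 ⊕ p-poly ⊕ ♯ 1 ⊕ (f-poly ⊕ ♯ 1 ⊕ p-poly) ⊕ ♯ 1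

    module _ {e : X → ℕ} (e-poly : PolyBounded size e) where

      pathTime-poly : PolyBounded size (λ x → pathTime (p x) (pred (f x)))
      pathTime-poly = poly-≤ size (λ x → pathTime-≤ (p x) (pred (f x)))
        (poly-* size f′ (♯ 6 ⊕ (p-poly ⊕ f′) ⊕ (p-poly ⊕ f′)))
        where
        f′ : PolyBounded size (pred ∘ f)
        f′ = poly-≤ size (λ x → pred[n]≤n) f-poly

      sortTime-poly : PolyBounded size (λ x → sortTime (n x) (r x) (p x) (e x) (b x) (f x))
      sortTime-poly = (n-poly ⊕ ♯ 1) ⊕ e-poly ⊕ ♯ 1 ⊕
        (p-poly ⊕ ♯ 1 ⊕ poly-* size r-poly (♯ 4) ⊕ b-poly) ⊕ ♯ 1 ⊕ p-poly ⊕ f-poly ⊕ ♯ 1 ⊕ ♯ 1 ⊕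
        ♯ 1 ⊕ e-poly ⊕ pathTime-poly ⊕
        ♯ 1 ⊕ ((p-poly ⊕ f-poly) ⊕ ♯ 1 ⊕ e-poly ⊕
               poly-≤ size (λ x → length-pathTokens-≤ (p x) (pred (f x))) pathTime-poly) ⊕ ♯ 1

-- The reductions

module _ {𝒦 : RegularFamily k ℓ} {K′ : Language k ℓ′} (f : With 𝒦 ℕ → Word k)
         (filters : ∀ r (r∈𝒦 : 𝒦 r) → IsFilterSequence ⟦ r ⟧ K′ (λ n → f ((r , r∈𝒦) , n))) where

  sortReduction : With 𝒦 (DAG k) → DAG k
  sortReduction (r , G) = addPath G (f (r , DAG.size G))

  sortReduction-correct : ∀ x →
    Problem.Positive (CTSᶠ 𝒦) x ⇔ Problem.Positive (CTS K′) (sortReduction x)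
  sortReduction-correct ((r , r∈𝒦) , G) = mk⇔
    (λ (σ , top , v∈K) →
      let w , i , w∈K′    = Equivalence.to (filter σ) v∈K
          σ′ , top′ , w≡  = addPath-sort⁺ G _ σ top i
      in  σ′ , top′ , subst K′ (sym w≡) w∈K′)
    (λ (σ′ , top′ , w∈K′) →
      let σ , top , i = addPath-sort⁻ G _ σ′ top′
      in  σ , top , Equivalence.from (filter σ) (_ , i , w∈K′))
    where
    open DAG G
    -- Every sorted word has length `size`, so one filter word serves all topological sorts.
    filter : ∀ σ → _
    filter σ = filters r r∈𝒦 size (sortedWord G σ) (length-tabulate _)

  shuffleReduction : With 𝒦 (List (Word k)) → List (Word k)
  shuffleReduction (r , U) = f (r , length (concat U)) ∷ U

  -- The filter word heads the tuple but comes second in `IsFilterSequence`, hence the swaps.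
  shuffleReduction-correct : ∀ x →
    Problem.Positive (CShᶠ 𝒦) x ⇔ Problem.Positive (CSh K′) (shuffleReduction x)
  shuffleReduction-correct ((r , r∈𝒦) , U) = mk⇔
    (λ (v , s , v∈K) →
      let w , i , w∈K′ = Equivalence.to (filter s) v∈K
      in  w , Interleaving.swap i ∷ s , w∈K′)
    (λ { (w , i ∷ s , w∈K′) →
      _ , s , Equivalence.from (filter s) (w , Interleaving.swap i , w∈K′) })
    where
    filter : ∀ {v} → Shuffle U v → _
    filter {v} s = filters r r∈𝒦 (length (concat U)) v (shuffle-length s)

  module _ (M : TM (Token k)) (c d : ℕ)
    (computes : ∀ x → TM.Computes_to_within_ M (encWith encℕ x) (encWord (f x))
                        (c * length (encWith encℕ x) ^ d + c)) where

    open Programs M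

    -- The machine counts letters of the encoding, whereas `f` is applied to the size of the
    -- instance; the two numbers are equal only up to a proof.
    computes-for : ∀ (x@((r , _) , n) : With 𝒦 ℕ) {n′} → n′ ≡ n →
      TM.Computes_to_within_ M (encRegex r ++ hash ∷ encℕ n′) (encWord (f x))
        (c * length (encWith encℕ x) ^ d + c)
    computes-for x refl = computes x

    -- Since `count x` does not exceed the encoding of `x`, its unary form makes the query to `M` no
    -- longer than the original input, and the time bound of `M` carries over.
    module Bounds {X : Set} (encX : X → List (Token k)) (count : X → ℕ)
                  (count≤ : ∀ x → count x ≤ length (encX x)) where

      size query-size query-time : With 𝒦 X → ℕ
      size       = length ∘ encWith encX
      query-size (r , x) = length (encWith {𝒦 = 𝒦} encℕ (r , count x))
      query-time x = c * query-size x ^ d + c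

      query-size≤ : ∀ x → query-size x ≤ size x
      query-size≤ ((r , _) , x) = begin
        length (encRegex r ++ hash ∷ encℕ (count x))          ≡⟨ length-++ (encRegex r) ⟩
        length (encRegex r) + suc (length (encℕ {k} (count x)))
          ≤⟨ +-monoʳ-≤ (length (encRegex r))
               (s≤s (≤-trans (≤-reflexive (length-replicate (count x))) (count≤ x))) ⟩
        length (encRegex r) + suc (length (encX x))           ≡⟨ length-++ (encRegex r) ⟨
        length (encRegex r ++ hash ∷ encX x)                  ∎
        where open ≤-Reasoning

      regex-poly : PolyBounded size (λ ((r , _) , _) → length (encRegex r))
      regex-poly = poly-≤ size (λ ((r , _) , _) → length-++-≤ˡ (encRegex r)) (poly-size size)

      instance-poly : PolyBounded size (λ (_ , x) → length (encX x))
      instance-poly = poly-≤ size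
        (λ ((r , _) , x) → ≤-trans (n≤1+n _) (length-++-≤ʳ (hash ∷ encX x) {encRegex r}))
        (poly-size size)

      query-time-poly : PolyBounded size query-time
      query-time-poly = poly-+ size
        (poly-* size (poly-const size c)
          (poly-≤ size (λ x → ^-monoˡ-≤ d (query-size≤ x)) (poly-^ size d)))
        (poly-const size c)

      filter-poly : PolyBounded size (λ (r , x) → length (encWord (f (r , count x))))
      filter-poly = poly-≤ size (λ (r , x) → length-result M (computes (r , count x)))
        (poly-+ size (poly-const size 1)
          (poly-+ size query-time-poly (poly-≤ size query-size≤ (poly-size size))))

      nonempty : ∀ x → 1 ≤ size x
      nonempty ((r , _) , x) =
        ≤-trans (s≤s z≤n) (length-++-≤ʳ (hash ∷ encX x) {encRegex r})

    sortReduction-polyTime : PolyTime (encWith encDAG) encDAG sortReduction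
    sortReduction-polyTime = program-polyTime (encWith encDAG) encDAG sortReduction _ sortProgram
      nonempty
      (sortTime-poly M size (poly-size size) regex-poly
        (poly-≤ size (λ (_ , G) → labels≤ G) instance-poly)
        query-time-poly filter-poly
        (poly-≤ size (λ (_ , G) → edges≤ G) instance-poly))
      run
      where
      labels : DAG k → List (Token k)
      labels G = encWord (tabulate (DAG.label G))

      length-labels : ∀ G → length (labels G) ≡ DAG.size G
      length-labels G =
        trans (length-map letter (tabulate (DAG.label G))) (length-tabulate (DAG.label G))

      labels≤ : ∀ G → length (labels G) ≤ length (encDAG G)
      labels≤ G rewrite encDAG≡ G = length-++-≤ˡ (labels G)

      edges≤ : ∀ G → length (concatMap (encEdge {k = k}) (DAG.edges G)) ≤ length (encDAG G)
      edges≤ G rewrite encDAG≡ G =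
        ≤-trans (n≤1+n _) (length-++-≤ʳ (hash ∷ concatMap encEdge (DAG.edges G)) {labels G})

      size≤ : ∀ G → DAG.size G ≤ length (encDAG G)
      size≤ G = ≤-trans (≤-reflexive (sym (length-labels G))) (labels≤ G)

      open Bounds encDAG DAG.size size≤

      run : ∀ (x@((r , r∈𝒦) , G) : With 𝒦 (DAG k)) →
        ∃[ t ] ∃[ ts ] contents t ≡ map inj₁ (encDAG (sortReduction x)) ×
          Halts sortProgram (written (map inj₁ (encWith encDAG x)) ∷ blanks)
            (sortTime (length (encWith encDAG x)) (length (encRegex r))
              (length (labels G)) (length (concatMap (encEdge {k = k}) (DAG.edges G)))
              (query-time x) (length (encWord (f ((r , r∈𝒦) , DAG.size G))))) (t ∷ ts)
      run ((r , r∈𝒦) , G)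
        rewrite encDAG≡ G | encDAG-addPath G (f ((r , r∈𝒦) , DAG.size G))
        with sort-halts (encRegex r) (labels G) (concatMap encEdge (DAG.edges G))
          (encWord (f ((r , r∈𝒦) , DAG.size G)))
          (noHash-encWord (tabulate (DAG.label G))) (noHash-encEdges (DAG.edges G))
          (computes-for ((r , r∈𝒦) , DAG.size G)
            (trans (letters-encWord (tabulate (DAG.label G))) (length-tabulate (DAG.label G))))
      ... | t , ts , e , h = t , ts ,
        trans e (cong₂ (λ i j → map inj₁ ((labels G ++ encWord (f ((r , r∈𝒦) , DAG.size G))) ++
                                           hash ∷ concatMap encEdge (DAG.edges G) ++
                                           pathTokens i (pred j)))
          (length-labels G) (length-map letter (f ((r , r∈𝒦) , DAG.size G)))) , h

    shuffleReduction-polyTime : PolyTime (encWith encTuple) encTuple shuffleReduction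
    shuffleReduction-polyTime = program-polyTime (encWith encTuple) encTuple shuffleReduction _
      shuffleProgram nonempty
      (shuffleTime-poly M size (poly-size size) regex-poly instance-poly query-time-poly filter-poly)
      run
      where
      letters≤length : ∀ (xs : List (Token k)) → letters xs ≤ length xs
      letters≤length []       = z≤n
      letters≤length (x ∷ xs) with isLetter x
      ... | true  = s≤s (letters≤length xs)
      ... | false = ≤-trans (letters≤length xs) (n≤1+n _)

      total≤ : ∀ U → length (concat U) ≤ length (encTuple U)
      total≤ U = subst (_≤ length (encTuple U)) (letters-encTuple U) (letters≤length (encTuple U))

      open Bounds encTuple (length ∘ concat) total≤

      run : ∀ (x@((r , r∈𝒦) , U) : With 𝒦 (List (Word k))) →
        ∃[ t ] ∃[ ts ] contents t ≡ map inj₁ (encTuple (shuffleReduction x)) ×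
          Halts shuffleProgram (written (map inj₁ (encWith encTuple x)) ∷ blanks)
            (shuffleTime (length (encWith encTuple x)) (length (encRegex r)) (length (encTuple U))
              (query-time x) (length (encWord (f ((r , r∈𝒦) , length (concat U)))))) (t ∷ ts)
      run ((r , r∈𝒦) , U)
        with t , ts , e , h ← shuffle-halts (encRegex r) (encTuple U) (noHash-encTuple U)
          (computes-for ((r , r∈𝒦) , length (concat U)) (letters-encTuple U)) =
        t , ts , trans e (cong (map inj₁) (sym
          (++-assoc (encWord (f ((r , r∈𝒦) , length (concat U)))) _ _))) , h

theorem3p5 : ∀ {ℓ ℓ′ : Level} (k : ℕ) (𝒦 : RegularFamily k ℓ) (K′ : Language k ℓ′) →
    FamilyShuffleReduces 𝒦 K′ →
    (CTSᶠ 𝒦 ≤ₚ CTS K′) × (CShᶠ 𝒦 ≤ₚ CSh K′)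
theorem3p5 k 𝒦 K′ (_ , f , filters , M , c , d , computes) =
  (sortReduction f filters ,
   sortReduction-polyTime f filters M c d computes ,
   sortReduction-correct f filters) ,
  (shuffleReduction f filters ,
   shuffleReduction-polyTime f filters M c d computes ,
   shuffleReduction-correct f filters)
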